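{- Let $p$ be an odd prime and $m\in\mathbb{Z}$ with $p\nmid m$. Let $s'(p)$ be the number of pairs $(i,j)$ with $1\le i<j\le (p-1)/2$ and $\widetilde{mi^2}>\widetilde{mj^2}$. Then $s'(p)\equiv \left\lfloor \frac{p+1}{8}\right\rfloor \pmod 2$.
   Context: For an integer $x$, $\{x\}_p$ denotes the least nonnegative residue of $x$ modulo $p$, and $\widetilde{x}=p-\{x\}_p$ if $\{x\}_p>p/2$, while $\widetilde{x}=\{x\}_p$ if $\{x\}_p<p/2$. $\lfloor\cdot\rfloor$ is the floor function. -}

module Defs where

open import Data.Nat using (ℕ; zero; suc; _+_; _*_; _∸_; _<_; _<?_; NonZero)
open import Data.Nat.Base using (_/_; _%_)
open import Data.Integer using (ℤ; +_)
import Data.Integer as ℤ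
open import Data.Integer.DivMod using (_%ℕ_)
open import Data.List using (List; []; _∷_; length; filter; concatMap; map)
open import Data.List.Base using (upTo)
open import Data.Product using (_×_; _,_; proj₁; proj₂)
open import Relation.Nullary.Decidable using (Dec; yes; no)

lnr : (p : ℕ) .{{_ : NonZero p}} → ℤ → ℕ
lnr p x = x %ℕ p

-- x̃ : p - {x}_p if {x}_p > p/2 (i.e. 2{x}_p > p), else {x}_p.
-- (For odd p, {x}_p = p/2 never happens.)
tilde : (p : ℕ) .{{_ : NonZero p}} → ℤ → ℕ
tilde p x with p <? 2 * lnr p x
... | yes _ = p ∸ lnr p x
... | no  _ = lnr p x

pairsBelow : ℕ → List (ℕ × ℕ)
pairsBelow n = concatMap (λ j → map (λ i → (suc i , suc j)) (upTo j)) (upTo n)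

sPrime : (p : ℕ) .{{_ : NonZero p}} → ℤ → ℕ
sPrime p m = length (filter
  (λ ij → tilde p (m ℤ.* (+ (proj₂ ij * proj₂ ij))) <? tilde p (m ℤ.* (+ (proj₁ ij * proj₁ ij))))
  (pairsBelow ((p ∸ 1) / 2)))

{-# OPTIONS --safe #-}

-- Write p = 2n + 1 and let G = {1, …, n} stand for the group F_p^* / ±1, ordered as a set of integers.
-- The idea is to group the unordered pairs {x, y} of elements of G by their ratio c = x / y, which is
-- determined up to inversion.  For t, x in G the sign of t - x is ε(h(t - x)) ε(h(t + x)), where h = 1/2
-- in F_p and ε is the sign of the residue of least absolute value; hence by Gauss's lemma the product
-- over x in G of the sign of (c x)~ - x is the Legendre symbol χ(c² - 1).  Since x ↦ (m x²)~ turns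
-- multiplication by c into multiplication by c², the parity of the number of inverted pairs with ratio
-- c ≠ ±1, ±√-1 is governed
--   * by χ(c² - 1) χ(c⁴ - 1) = χ(c² + 1) if p ≡ 3 mod 4, where x ↦ (m x²)~ is a permutation of G;
--   * by χ(c² - 1) if p ≡ 1 mod 4, where x ↦ (m x²)~ is constant on the pairs {x, √-1 x}.
-- Finally the Jacobsthal sums of χ(c² ± 1) count the c with a negative sign, and χ(2) corrects for
-- the one exceptional ratio.
module Submission where

open import Defs
open import Data.Nat using (ℕ; _+_; _/_; _%_; NonZero)
open import Data.Nat.Primality using (Prime)
open import Data.Integer using (ℤ; +_)
open import Data.Integer.Divisibility using (_∣_)
open import Relation.Nullary using (¬_)
open import Relation.Binary.PropositionalEquality using (_≡_)

import Algebra.Properties.CommutativeMonoid.Sum as MonoidSum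
open import Algebra.Bundles using (CommutativeMonoid)
open import Data.Bool using (true; false; if_then_else_)
open import Data.Empty using (⊥-elim)
open import Data.Fin using (Fin; toℕ; fromℕ<; opposite; punchIn; punchOut)
import Data.Fin as Fin
open import Data.Fin.Permutation using (Permutation′; permutation)
import Data.Fin.Properties as Fin
open import Data.Integer using (-[1+_])
import Data.Integer as ℤ
open import Data.Integer.DivMod using (_%ℕ_; _/ℕ_; n%ℕd<d; a≡a%ℕn+[a/ℕn]*n)
open import Data.Integer.Divisibility.Signed using (divides) renaming (_∣_ to _∣ℤ_)
import Data.Integer.Divisibility.Signed as ℤ∣
import Data.Integer.Properties as ℤ
open import Data.Integer.Tactic.RingSolver using (solve-∀)
open import Data.List using (List; length; filter; map; concatMap; _++_; [_]; _∷ʳ_; upTo)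
import Data.List.Properties as List
open import Data.Nat using (zero; suc; _<_; _≤_; s≤s; z≤n)
import Data.Nat as ℕ
import Data.Nat.Divisibility as ℕ∣
import Data.Nat.DivMod as ℕ
open import Data.Nat.Primality using (euclidsLemma; prime⇒nonTrivial)
import Data.Nat.Properties as ℕ
import Data.Nat.Tactic.RingSolver as ℕSolver
open import Data.Product using (∃; _×_; _,_; proj₁; proj₂)
open import Data.Sum using (_⊎_; inj₁; inj₂)
import Data.Sum as Sum
open import Function using (_∘_)
open import Function.Definitions using (Injective)
open import Relation.Binary.Bundles using (Setoid)
open import Relation.Binary.Definitions using (tri<; tri≈; tri>)
open import Relation.Binary.PropositionalEquality using (_≢_; refl; sym; trans; cong; cong₂; subst; module ≡-Reasoning)
open import Relation.Nullary using (Dec; yes; no; does; contradiction)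
open import Relation.Nullary.Decidable using (map′; dec-true; dec-false; decidable-stable; ¬?; _×-dec_)
open import Relation.Unary using (Pred; Decidable)

-- An inverted pair {x, y} occurs at both ratios x / y and y / x, so its count is seen doubled, and
-- the sum over all ratios has to be known modulo 4. Passing from c to 1 / c makes this possible:
-- ratios come in pairs with equal counts, and a self-inverse ratio has c² = ±1, where x and c x get
-- the same value of (m x²)~ and nothing is inverted. Hence the parities of the single counts
-- suffice.
--
-- The symbol χ is available only as the product in Gauss's lemma. Its multiplicativity is formal,
-- but the character sums need some a with χ(a) = -1. For p ≡ 3 mod 4 this is a = -1. For p ≡ 1 mod
-- 4 it is a nonsquare, and its value is found by pairing x with ±a / x, in the manner of Wilson's
-- theorem.
--
-- The character sums give K = ⌊(p + 1) / 4⌋ negative signs, and the sign at the exceptional ratio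
-- is χ(2) = (-1)^K. Discarding it rounds K down to an even number, so half of the result is ⌊K / 2⌋
-- = ⌊(p + 1) / 8⌋.

abstract
  -- If `y` had no preimage, closing the gap at `y` would inject `Fin (suc n)` into `Fin n`.
  injective⇒surjective : ∀ {n} {f : Fin n → Fin n} → Injective _≡_ _≡_ f → ∀ y → ∃ λ x → f x ≡ y
  injective⇒surjective {suc n} {f} inj y with Fin.any? (λ x → f x Fin.≟ y)
  ... | yes found = found
  ... | no missing = contradiction (Fin.injective⇒≤ out-inj) ℕ.1+n≰n
    where
    y≢f : ∀ x → y ≢ f x
    y≢f x eq = missing (x , sym eq)
    out-inj : Injective _≡_ _≡_ (λ x → punchOut (y≢f x))
    out-inj {i} {j} eq = inj (Fin.punchOut-injective (y≢f i) (y≢f j) eq)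

-- A section of `f` is injective, hence surjective, so every argument is a value of the section, and
-- there `f` can be undone.
surjective⇒injective : ∀ {n} {f : Fin n → Fin n} → (∀ y → ∃ λ x → f x ≡ y) → Injective _≡_ _≡_ f
surjective⇒injective {f = f} surj {x} {x′} eq = begin
  x            ≡⟨ proj₂ (section-surj x) ⟨
  section a    ≡⟨ cong section a≡a′ ⟩
  section a′   ≡⟨ proj₂ (section-surj x′) ⟩
  x′           ∎
  where
  open ≡-Reasoning
  section = proj₁ ∘ surj
  section-surj = injective⇒surjective {f = section}
    (λ {y} {y′} e → trans (sym (proj₂ (surj y))) (trans (cong f e) (proj₂ (surj y′))))
  a = proj₁ (section-surj x)
  a′ = proj₁ (section-surj x′)
  f-section : ∀ z → f z ≡ proj₁ (section-surj z)
  f-section z = trans (cong f (sym (proj₂ (section-surj z)))) (proj₂ (surj _))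
  a≡a′ : a ≡ a′
  a≡a′ = trans (sym (f-section x)) (trans eq (f-section x′))

injection⇒permutation : ∀ {n} (f : Fin n → Fin n) → Injective _≡_ _≡_ f → Permutation′ n
injection⇒permutation f inj = permutation f (proj₁ ∘ surj) (proj₂ ∘ surj) (λ x → inj (proj₂ (surj (f x))))
  where surj = injective⇒surjective inj

-- Finite sums and products

module FiniteSum {a ℓ} (M : CommutativeMonoid a ℓ) where
  open CommutativeMonoid M
    renaming (refl to ≈-refl; sym to ≈-sym; trans to ≈-trans; reflexive to ≈-reflexive)
  open MonoidSum M public
  open import Relation.Binary.Reasoning.Setoid setoid

  sum-reindex : ∀ {n} {f : Fin n → Fin n} → Injective _≡_ _≡_ f → (g : Fin n → Carrier) →
                sum g ≈ sum (g ∘ f)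
  sum-reindex {f = f} inj g = sum-permute g (injection⇒permutation f inj)

  sum-neutral : ∀ {n} {g : Fin n → Carrier} → (∀ x → g x ≈ ε) → sum g ≈ ε
  sum-neutral {n} eq = ≈-trans (sum-cong-≋ eq) (sum-replicate-zero n)

  sum-concentrated : ∀ {n} {g : Fin n → Carrier} (c : Fin n) → (∀ x → x ≢ c → g x ≈ ε) → sum g ≈ g c
  sum-concentrated {suc n} {g} c off = ≈-trans (sum-remove {i = c} g)
    (≈-trans (∙-congˡ (sum-neutral (λ x → off (punchIn c x) (Fin.punchInᵢ≢i c x)))) (identityʳ _))

  sum-toℕ-suc : ∀ n (f : ℕ → Carrier) → sum {suc n} (f ∘ toℕ) ≈ sum {n} (f ∘ toℕ) ∙ f n
  sum-toℕ-suc n f = ≈-trans (sum-init-last {n} (f ∘ toℕ))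
    (∙-cong (≈-reflexive (sum-cong-≗ {n} (λ i → cong f (Fin.toℕ-inject₁ i)))) (≈-reflexive (cong f (Fin.toℕ-fromℕ n))))

  sum-toℕ-+ : ∀ m n (f : ℕ → Carrier) →
              sum {m ℕ.+ n} (f ∘ toℕ) ≈ sum {m} (f ∘ toℕ) ∙ sum {n} (λ i → f (m ℕ.+ toℕ i))
  sum-toℕ-+ zero n f = ≈-sym (identityˡ _)
  sum-toℕ-+ (suc m) n f = ≈-trans (∙-congˡ (sum-toℕ-+ m n (f ∘ suc))) (≈-sym (assoc _ _ _))

  module _ {n} (σ : Fin n → Fin n) (g : Fin n → Carrier) where
    -- `ascendingPart` keeps the smaller element of each two-element orbit of `σ`.
    fixedPart ascendingPart : Fin n → Carrier
    fixedPart x = if does (σ x Fin.≟ x) then g x else ε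
    ascendingPart x = if does (x Fin.<? σ x) then g x else ε

    -- The larger element of a two-element orbit is caught by `ascendingPart (σ x)`, whose sum is
    -- that of `ascendingPart` because `σ` is a permutation. Over a general monoid this serves both
    -- sums, where the doubled part gives divisibility, and products of signs, where it cancels.
    sum-involution : (∀ x → σ (σ x) ≡ x) → (∀ x → g (σ x) ≈ g x) →
                     sum g ≈ sum fixedPart ∙ (sum ascendingPart ∙ sum ascendingPart)
    sum-involution σσ gσ = begin
      sum g
        ≈⟨ sum-cong-≋ split ⟩
      sum (λ x → fixedPart x ∙ (ascendingPart x ∙ ascendingPart (σ x)))
        ≈⟨ ∑-distrib-+ fixedPart _ ⟩
      sum fixedPart ∙ sum (λ x → ascendingPart x ∙ ascendingPart (σ x))
        ≈⟨ ∙-congˡ (∑-distrib-+ ascendingPart _) ⟩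
      sum fixedPart ∙ (sum ascendingPart ∙ sum (ascendingPart ∘ σ))
        ≈⟨ ∙-congˡ (∙-congˡ (sum-reindex σ-inj ascendingPart)) ⟨
      sum fixedPart ∙ (sum ascendingPart ∙ sum ascendingPart) ∎
      where
      σ-inj : Injective _≡_ _≡_ σ
      σ-inj {x} {y} eq = trans (sym (σσ x)) (trans (cong σ eq) (σσ y))
      split : ∀ x → g x ≈ fixedPart x ∙ (ascendingPart x ∙ ascendingPart (σ x))
      split x rewrite σσ x with Fin.<-cmp x (σ x)
      ... | tri< lt ne ngt
        rewrite dec-false (σ x Fin.≟ x) (ne ∘ sym) | dec-true (x Fin.<? σ x) lt
              | dec-false (σ x Fin.<? x) ngt =
          ≈-sym (≈-trans (identityˡ _) (identityʳ _))
      ... | tri≈ nlt eq ngt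
        rewrite dec-true (σ x Fin.≟ x) (sym eq) | dec-false (x Fin.<? σ x) nlt
              | dec-false (σ x Fin.<? x) ngt =
          ≈-sym (≈-trans (∙-congˡ (identityˡ _)) (identityʳ _))
      ... | tri> nlt ne gt
        rewrite dec-false (σ x Fin.≟ x) (ne ∘ sym) | dec-false (x Fin.<? σ x) nlt
              | dec-true (σ x Fin.<? x) gt =
          ≈-sym (≈-trans (identityˡ _) (≈-trans (identityˡ _) (gσ x)))

module Σ where
  open FiniteSum ℤ.+-0-commutativeMonoid public
module Π where
  open FiniteSum ℤ.*-1-commutativeMonoid public

sum-∣ : ∀ {n} d (f : Fin n → ℤ) → (∀ x → d ∣ℤ f x) → d ∣ℤ Σ.sum f
sum-∣ {zero} d f all = divides (+ 0) refl
sum-∣ {suc n} d f all = ℤ∣.∣m∣n⇒∣m+n (all Fin.zero) (sum-∣ d (f ∘ Fin.suc) (all ∘ Fin.suc))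

sum-neg : ∀ {n} (f : Fin n → ℤ) → Σ.sum (λ x → ℤ.- f x) ≡ ℤ.- Σ.sum f
sum-neg {zero} f = refl
sum-neg {suc n} f = trans (cong (ℤ._+_ (ℤ.- f Fin.zero)) (sum-neg (f ∘ Fin.suc)))
  (sym (ℤ.neg-distrib-+ (f Fin.zero) (Σ.sum (f ∘ Fin.suc))))

sum-sub : ∀ {n} (f g : Fin n → ℤ) → Σ.sum (λ x → f x ℤ.- g x) ≡ Σ.sum f ℤ.- Σ.sum g
sum-sub f g = trans (Σ.∑-distrib-+ f (λ x → ℤ.- g x)) (cong (ℤ._+_ (Σ.sum f)) (sum-neg g))

sum-ones : ∀ n → Σ.sum {n} (λ _ → + 1) ≡ + n
sum-ones zero = refl
sum-ones (suc n) = cong (ℤ._+_ (+ 1)) (sum-ones n)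

sum-except : ∀ {n} (f g : Fin n → ℤ) c → f c ≡ + 0 → (∀ x → x ≢ c → f x ≡ g x) →
             Σ.sum f ≡ Σ.sum g ℤ.- g c
sum-except f g c fc≡0 off = begin
  Σ.sum f
    ≡⟨ x≡y-[y-x] (Σ.sum f) (Σ.sum g) ⟩
  Σ.sum g ℤ.- (Σ.sum g ℤ.- Σ.sum f)
    ≡⟨ cong (ℤ._-_ (Σ.sum g)) (sum-sub g f) ⟨
  Σ.sum g ℤ.- Σ.sum (λ x → g x ℤ.- f x)
    ≡⟨ cong (ℤ._-_ (Σ.sum g)) (Σ.sum-concentrated c (λ x ne → ℤ.i≡j⇒i-j≡0 (sym (off x ne)))) ⟩
  Σ.sum g ℤ.- (g c ℤ.- f c)
    ≡⟨ cong (λ z → Σ.sum g ℤ.- (g c ℤ.- z)) fc≡0 ⟩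
  Σ.sum g ℤ.- (g c ℤ.- + 0)
    ≡⟨ cong (ℤ._-_ (Σ.sum g)) (ℤ.+-identityʳ (g c)) ⟩
  Σ.sum g ℤ.- g c ∎
  where
  open ≡-Reasoning
  x≡y-[y-x] : ∀ x y → x ≡ y ℤ.- (y ℤ.- x)
  x≡y-[y-x] = solve-∀

-- An orbit of two points contributes twice an even number, a fixed point contributes 0.
4∣-involution : ∀ {n} (σ : Fin n → Fin n) (f : Fin n → ℤ) → (∀ x → σ (σ x) ≡ x) →
                (∀ x → f (σ x) ≡ f x) → (∀ x → + 2 ∣ℤ f x) → (∀ x → σ x ≡ x → f x ≡ + 0) →
                + 4 ∣ℤ Σ.sum f
4∣-involution σ f σσ fσ even fix
  with sum-∣ (+ 2) (Σ.ascendingPart σ f) asc-even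
  where
  asc-even : ∀ x → + 2 ∣ℤ Σ.ascendingPart σ f x
  asc-even x with does (x Fin.<? σ x)
  ... | true = even x
  ... | false = divides (+ 0) refl
... | divides q eq = divides q (begin
    Σ.sum f
      ≡⟨ Σ.sum-involution σ f σσ fσ ⟩
    Σ.sum (Σ.fixedPart σ f) ℤ.+ (Σ.sum (Σ.ascendingPart σ f) ℤ.+ Σ.sum (Σ.ascendingPart σ f))
      ≡⟨ cong₂ (λ u v → u ℤ.+ (v ℤ.+ v)) (Σ.sum-neutral fixed≡0) eq ⟩
    + 0 ℤ.+ (q ℤ.* + 2 ℤ.+ q ℤ.* + 2)
      ≡⟨ double q ⟩
    q ℤ.* + 4 ∎)
  where
  open ≡-Reasoning
  double : ∀ q → + 0 ℤ.+ (q ℤ.* + 2 ℤ.+ q ℤ.* + 2) ≡ q ℤ.* + 4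
  double = solve-∀
  fixed≡0 : ∀ x → Σ.fixedPart σ f x ≡ + 0
  fixed≡0 x with σ x Fin.≟ x
  ... | yes e = fix x e
  ... | no _ = refl

-- Signs and the parity of their products

IsSign : ℤ → Set
IsSign z = z ≡ + 1 ⊎ z ≡ -[1+ 0 ]

isSign-* : ∀ {u v} → IsSign u → IsSign v → IsSign (u ℤ.* v)
isSign-* (inj₁ refl) (inj₁ refl) = inj₁ refl
isSign-* (inj₁ refl) (inj₂ refl) = inj₂ refl
isSign-* (inj₂ refl) (inj₁ refl) = inj₂ refl
isSign-* (inj₂ refl) (inj₂ refl) = inj₁ refl

sign²≡1 : ∀ {u} → IsSign u → u ℤ.* u ≡ + 1
sign²≡1 (inj₁ refl) = refl
sign²≡1 (inj₂ refl) = refl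

isSign-Π : ∀ {n} {w : Fin n → ℤ} → (∀ x → IsSign (w x)) → IsSign (Π.sum w)
isSign-Π {zero} s = inj₁ refl
isSign-Π {suc n} s = isSign-* (s Fin.zero) (isSign-Π (s ∘ Fin.suc))

Π-zero : ∀ {n} {w : Fin n → ℤ} c → w c ≡ + 0 → Π.sum w ≡ + 0
Π-zero {w = w} Fin.zero eq = cong (ℤ._* Π.sum (w ∘ Fin.suc)) eq
Π-zero {w = w} (Fin.suc c) eq =
  trans (cong (w Fin.zero ℤ.*_) (Π-zero {w = w ∘ Fin.suc} c eq)) (ℤ.*-zeroʳ (w Fin.zero))

-- The indicator of the negative integers, which turns products of signs into counts.
neg : ℤ → ℤ
neg (+ _) = + 0
neg -[1+ _ ] = + 1

-- Modulo 2, `neg` is additive on products of signs: only (-1)(-1) deviates, and by 2.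
neg-Π : ∀ {n} {w : Fin n → ℤ} → (∀ x → IsSign (w x)) → + 2 ∣ℤ Σ.sum (neg ∘ w) ℤ.- neg (Π.sum w)
neg-Π {zero} s = divides (+ 0) refl
neg-Π {suc n} {w} s = subst (+ 2 ∣ℤ_) (regroup (neg (w Fin.zero)) _ _ _)
  (ℤ∣.∣m∣n⇒∣m+n (neg-* (s Fin.zero) (isSign-Π (s ∘ Fin.suc))) (neg-Π (s ∘ Fin.suc)))
  where
  regroup : ∀ a b c d → (a ℤ.+ b ℤ.- c) ℤ.+ (d ℤ.- b) ≡ a ℤ.+ d ℤ.- c
  regroup = solve-∀
  neg-* : ∀ {u v} → IsSign u → IsSign v → + 2 ∣ℤ neg u ℤ.+ neg v ℤ.- neg (u ℤ.* v)
  neg-* (inj₁ refl) (inj₁ refl) = divides (+ 0) refl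
  neg-* (inj₁ refl) (inj₂ refl) = divides (+ 0) refl
  neg-* (inj₂ refl) (inj₁ refl) = divides (+ 0) refl
  neg-* (inj₂ refl) (inj₂ refl) = divides (+ 1) refl

-- Each two-element orbit contributes the square of a sign.
Π-involution : ∀ {n} (σ : Fin n → Fin n) (f : Fin n → ℤ) → (∀ x → σ (σ x) ≡ x) →
               (∀ x → f (σ x) ≡ f x) → (∀ x → IsSign (f x)) →
               Π.sum f ≡ Π.sum (Π.fixedPart σ f)
Π-involution σ f σσ fσ s = begin
  Π.sum f
    ≡⟨ Π.sum-involution σ f σσ fσ ⟩
  Π.sum (Π.fixedPart σ f) ℤ.* (A ℤ.* A)
    ≡⟨ cong (Π.sum (Π.fixedPart σ f) ℤ.*_) (sign²≡1 (isSign-Π asc-sign)) ⟩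
  Π.sum (Π.fixedPart σ f) ℤ.* + 1
    ≡⟨ ℤ.*-identityʳ _ ⟩
  Π.sum (Π.fixedPart σ f) ∎
  where
  open ≡-Reasoning
  A = Π.sum (Π.ascendingPart σ f)
  asc-sign : ∀ x → IsSign (Π.ascendingPart σ f x)
  asc-sign x with does (x Fin.<? σ x)
  ... | true = s x
  ... | false = inj₁ refl

-- Lengths of filtered lists as finite sums

length-filter-map-upTo : ∀ {A : Set} {ℓ} {P : Pred A ℓ} (P? : Decidable P) (g : ℕ → A) n (v : ℕ → ℤ) →
  (∀ i → i < n → (P (g i) → v i ≡ + 1) × (¬ P (g i) → v i ≡ + 0)) →
  + length (filter P? (map g (upTo n))) ≡ Σ.sum {n} (v ∘ toℕ)
length-filter-map-upTo P? g zero v spec = refl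
length-filter-map-upTo {P = P} P? g (suc n) v spec = begin
  + length (filter P? (map g (upTo (suc n))))
    ≡⟨ cong (λ l → + length (filter P? (map g l))) (List.upTo-∷ʳ n) ⟨
  + length (filter P? (map g (upTo n ∷ʳ n)))
    ≡⟨ cong (λ l → + length (filter P? l)) (List.map-++ g (upTo n) [ n ]) ⟩
  + length (filter P? (map g (upTo n) ++ [ g n ]))
    ≡⟨ cong (+_ ∘ length) (List.filter-++ P? (map g (upTo n)) [ g n ]) ⟩
  + length (filter P? (map g (upTo n)) ++ filter P? [ g n ])
    ≡⟨ cong +_ (List.length-++ (filter P? (map g (upTo n)))) ⟩
  + length (filter P? (map g (upTo n))) ℤ.+ + length (filter P? [ g n ])
    ≡⟨ cong₂ ℤ._+_ (length-filter-map-upTo P? g n v (λ i lt → spec i (ℕ.m<n⇒m<1+n lt))) last ⟩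
  Σ.sum {n} (v ∘ toℕ) ℤ.+ v n
    ≡⟨ Σ.sum-toℕ-suc n v ⟨
  Σ.sum {suc n} (v ∘ toℕ) ∎
  where
  open ≡-Reasoning
  last : + length (filter P? [ g n ]) ≡ v n
  last with P? (g n)
  ... | yes y = sym (proj₁ (spec n (ℕ.n<1+n n)) y)
  ... | no ¬y = sym (proj₂ (spec n (ℕ.n<1+n n)) ¬y)

-- The pairs (i , j) of pairsBelow n are 1-based, the arguments of v are 0-based.
length-filter-pairsBelow : ∀ {ℓ} {P : Pred (ℕ × ℕ) ℓ} (P? : Decidable P) (v : ℕ → ℕ → ℤ) →
  (∀ i j → v i j ≡ v j i) → (∀ i → v i i ≡ + 0) →
  (∀ i j → i < j → (P (suc i , suc j) → v i j ≡ + 1) × (¬ P (suc i , suc j) → v i j ≡ + 0)) →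
  ∀ n → + length (filter P? (pairsBelow n)) ℤ.+ + length (filter P? (pairsBelow n))
        ≡ Σ.sum {n} (λ j → Σ.sum {n} (λ i → v (toℕ i) (toℕ j)))
length-filter-pairsBelow P? v symm diag spec zero = refl
length-filter-pairsBelow P? v symm diag spec (suc n) = begin
  + length (filter P? (pairsBelow (suc n))) ℤ.+ + length (filter P? (pairsBelow (suc n)))
    ≡⟨ cong (λ z → z ℤ.+ z) last-row ⟩
  (s ℤ.+ r) ℤ.+ (s ℤ.+ r)
    -- The square of side `n` grows by a row and a column, both equal to `r` by symmetry, and by the
    -- diagonal entry `v n n`, which is the `+ 0`.
    ≡⟨ regroup s r ⟩
  (s ℤ.+ s) ℤ.+ r ℤ.+ (r ℤ.+ + 0)
    ≡⟨ cong₂ ℤ._+_ (cong (ℤ._+ r) (length-filter-pairsBelow P? v symm diag spec n)) (cong (λ z → r ℤ.+ z) (sym (diag n))) ⟩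
  square ℤ.+ r ℤ.+ (r ℤ.+ v n n)
    ≡⟨ cong₂ ℤ._+_ (cong (ℤ._+_ square) (Σ.sum-cong-≗ {n} (λ i → symm n (toℕ i)))) (Σ.sum-toℕ-suc n (λ i → v i n)) ⟨
  square ℤ.+ Σ.sum {n} (λ j → v n (toℕ j)) ℤ.+ column
    ≡⟨ cong (ℤ._+ column) (Σ.∑-distrib-+ {n} _ _) ⟨
  Σ.sum {n} (λ j → Σ.sum {n} (λ i → v (toℕ i) (toℕ j)) ℤ.+ v n (toℕ j)) ℤ.+ column
    ≡⟨ cong (ℤ._+ column) (Σ.sum-cong-≗ {n} (λ j → Σ.sum-toℕ-suc n (λ i → v i (toℕ j)))) ⟨
  Σ.sum {n} (λ j → Σ.sum {suc n} (λ i → v (toℕ i) (toℕ j))) ℤ.+ column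
    ≡⟨ Σ.sum-toℕ-suc n (λ j → Σ.sum {suc n} (λ i → v (toℕ i) j)) ⟨
  Σ.sum {suc n} (λ j → Σ.sum {suc n} (λ i → v (toℕ i) (toℕ j))) ∎
  where
  open ≡-Reasoning
  s = + length (filter P? (pairsBelow n))
  r = Σ.sum {n} (λ i → v (toℕ i) n)
  square = Σ.sum {n} (λ j → Σ.sum {n} (λ i → v (toℕ i) (toℕ j)))
  column = Σ.sum {suc n} (λ i → v (toℕ i) n)
  regroup : ∀ s r → (s ℤ.+ r) ℤ.+ (s ℤ.+ r) ≡ (s ℤ.+ s) ℤ.+ r ℤ.+ (r ℤ.+ + 0)
  regroup = solve-∀
  row : ℕ → List (ℕ × ℕ)
  row j = map (λ i → (suc i , suc j)) (upTo j)
  pairs-suc : pairsBelow (suc n) ≡ pairsBelow n ++ row n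
  pairs-suc = begin
    concatMap row (upTo (suc n))                   ≡⟨ cong (concatMap row) (List.upTo-∷ʳ n) ⟨
    concatMap row (upTo n ∷ʳ n)                    ≡⟨ List.concatMap-++ row (upTo n) [ n ] ⟩
    concatMap row (upTo n) ++ concatMap row [ n ]  ≡⟨ cong (pairsBelow n ++_) (List.++-identityʳ (row n)) ⟩
    pairsBelow n ++ row n                          ∎
  last-row : + length (filter P? (pairsBelow (suc n))) ≡ s ℤ.+ r
  last-row = begin
    + length (filter P? (pairsBelow (suc n)))
      ≡⟨ cong (λ l → + length (filter P? l)) pairs-suc ⟩
    + length (filter P? (pairsBelow n ++ row n))
      ≡⟨ cong (+_ ∘ length) (List.filter-++ P? (pairsBelow n) (row n)) ⟩
    + length (filter P? (pairsBelow n) ++ filter P? (row n))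
      ≡⟨ cong +_ (List.length-++ (filter P? (pairsBelow n))) ⟩
    s ℤ.+ + length (filter P? (row n))
      ≡⟨ cong (ℤ._+_ s) (length-filter-map-upTo P? (λ i → (suc i , suc n)) n (λ i → v i n) (λ i → spec i n)) ⟩
    s ℤ.+ r ∎

-- The sign `sgn a b` of a - b, and the powers `alt d` of -1

sgn : ℕ → ℕ → ℤ
sgn a b with ℕ.<-cmp a b
... | tri< _ _ _ = -[1+ 0 ]
... | tri≈ _ _ _ = + 0
... | tri> _ _ _ = + 1

sgn-< : ∀ {a b} → a < b → sgn a b ≡ -[1+ 0 ]
sgn-< {a} {b} lt with ℕ.<-cmp a b
... | tri< _ _ _ = refl
... | tri≈ ¬lt _ _ = contradiction lt ¬lt
... | tri> ¬lt _ _ = contradiction lt ¬lt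

sgn-≡ : ∀ {a b} → a ≡ b → sgn a b ≡ + 0
sgn-≡ {a} {b} eq with ℕ.<-cmp a b
... | tri< _ ne _ = contradiction eq ne
... | tri≈ _ _ _ = refl
... | tri> _ ne _ = contradiction eq ne

sgn-> : ∀ {a b} → b < a → sgn a b ≡ + 1
sgn-> {a} {b} gt with ℕ.<-cmp a b
... | tri< _ _ ¬gt = contradiction gt ¬gt
... | tri≈ _ _ ¬gt = contradiction gt ¬gt
... | tri> _ _ _ = refl

sgn-antisym : ∀ a b → sgn a b ≡ ℤ.- sgn b a
sgn-antisym a b with ℕ.<-cmp a b
... | tri< lt _ _ = cong ℤ.-_ (sym (sgn-> lt))
... | tri≈ _ eq _ = cong ℤ.-_ (sym (sgn-≡ (sym eq)))
... | tri> _ _ gt = cong ℤ.-_ (sym (sgn-< gt))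

sgn-sign : ∀ {a b} → a ≢ b → IsSign (sgn a b)
sgn-sign {a} {b} ne with ℕ.<-cmp a b
... | tri< _ _ _ = inj₂ refl
... | tri≈ _ eq _ = contradiction eq ne
... | tri> _ _ _ = inj₁ refl

sgn-suc : ∀ a b → sgn (suc a) (suc b) ≡ sgn a b
sgn-suc a b with ℕ.<-cmp a b
... | tri< lt _ _ = sgn-< (s≤s lt)
... | tri≈ _ eq _ = sgn-≡ (cong suc eq)
... | tri> _ _ gt = sgn-> (s≤s gt)

sgn-≯ : ∀ {a b} → ¬ (b < a) → sgn a b ≡ -[1+ 0 ] ⊎ sgn a b ≡ + 0
sgn-≯ {a} {b} ¬gt with ℕ.<-cmp a b
... | tri< _ _ _ = inj₁ refl
... | tri≈ _ _ _ = inj₂ refl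
... | tri> _ _ gt = contradiction gt ¬gt

alt : ℕ → ℤ
alt zero = + 1
alt (suc d) = ℤ.- alt d

alt-sign : ∀ d → IsSign (alt d)
alt-sign zero = inj₁ refl
alt-sign (suc d) with alt-sign d
... | inj₁ e = inj₂ (cong ℤ.-_ e)
... | inj₂ e = inj₁ (cong ℤ.-_ e)

alt-+ : ∀ a b → alt (a ℕ.+ b) ≡ alt a ℤ.* alt b
alt-+ zero b = sym (ℤ.*-identityˡ (alt b))
alt-+ (suc a) b = trans (cong ℤ.-_ (alt-+ a b)) (ℤ.neg-distribˡ-* (alt a) (alt b))

alt-double : ∀ a → alt (a ℕ.+ a) ≡ + 1
alt-double a = trans (alt-+ a a) (sign²≡1 (alt-sign a))

-- Only odd exponents contribute: there are k of them in 1, ..., 2k and k + 1 in 1, ..., 2k + 1.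
-- These products are χ(2) for p ≡ 1 and p ≡ 3 mod 4.
Π-alt-even : ∀ k → Π.sum {k ℕ.+ k} (λ x → alt (suc (toℕ x))) ≡ alt k
Π-alt-odd : ∀ k → Π.sum {suc (k ℕ.+ k)} (λ x → alt (suc (toℕ x))) ≡ alt (suc k)

Π-alt-even zero = refl
Π-alt-even (suc k) = begin
  Π.sum {suc (k ℕ.+ suc k)} (λ x → alt (suc (toℕ x)))
    ≡⟨ Π.sum-toℕ-suc (k ℕ.+ suc k) (alt ∘ suc) ⟩
  Π.sum {k ℕ.+ suc k} (λ x → alt (suc (toℕ x))) ℤ.* alt (suc k ℕ.+ suc k)
    ≡⟨ cong₂ ℤ._*_ (trans (cong (λ j → Π.sum {j} (λ x → alt (suc (toℕ x)))) (ℕ.+-suc k k)) (Π-alt-odd k)) (alt-double (suc k)) ⟩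
  alt (suc k) ℤ.* + 1
    ≡⟨ ℤ.*-identityʳ (alt (suc k)) ⟩
  alt (suc k) ∎
  where open ≡-Reasoning
Π-alt-odd k = begin
  Π.sum {suc (k ℕ.+ k)} (λ x → alt (suc (toℕ x)))
    ≡⟨ Π.sum-toℕ-suc (k ℕ.+ k) (alt ∘ suc) ⟩
  Π.sum {k ℕ.+ k} (λ x → alt (suc (toℕ x))) ℤ.* (ℤ.- alt (k ℕ.+ k))
    ≡⟨ cong₂ (λ a b → a ℤ.* (ℤ.- b)) (Π-alt-even k) (alt-double k) ⟩
  alt k ℤ.* -[1+ 0 ]
    ≡⟨ trans (ℤ.*-comm (alt k) -[1+ 0 ]) (ℤ.-1*i≡-i (alt k)) ⟩
  ℤ.- alt k ∎
  where open ≡-Reasoning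

even⊎odd : ∀ d → ∃ λ w → d ≡ w ℕ.+ w ⊎ d ≡ suc (w ℕ.+ w)
even⊎odd zero = 0 , inj₁ refl
even⊎odd (suc d) with even⊎odd d
... | w , inj₁ e = w , inj₂ (cong suc e)
... | w , inj₂ e = suc w , inj₁ (trans (cong suc e) (cong suc (sym (ℕ.+-suc w w))))

double-injective : ∀ {a b} → a ℤ.+ a ≡ b ℤ.+ b → a ≡ b
double-injective {a} {b} h = ℤ.*-cancelˡ-≡ (+ 2) a b (trans (2* a) (trans h (sym (2* b))))
  where
  2* : ∀ a → + 2 ℤ.* a ≡ a ℤ.+ a
  2* = solve-∀

odd≢even : ∀ k a → ¬ (+ suc (k ℕ.+ k) ≡ a ℤ.+ a)
odd≢even k a h = contradiction (ℤ∣.∣⇒∣ᵤ (divides (a ℤ.- + k) (trans (sym (split (+ k))) (trans (cong (ℤ._- (+ k ℤ.+ + k)) h) (collect a (+ k))))))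
  λ 2∣1 → ℕ∣.>⇒∤ (s≤s (s≤s z≤n)) 2∣1
  where
  split : ∀ k → + 1 ℤ.+ (k ℤ.+ k) ℤ.- (k ℤ.+ k) ≡ + 1
  split = solve-∀
  collect : ∀ a k → a ℤ.+ a ℤ.- (k ℤ.+ k) ≡ (a ℤ.- k) ℤ.* + 2
  collect = solve-∀

-- Residues of least absolute value

module HalfSystem (p n : ℕ) .{{p≢0 : NonZero p}} (p≡1+2n : p ≡ suc (n ℕ.+ n)) (p-prime : Prime p) where

  infix 4 _≈_
  record _≈_ (a b : ℤ) : Set where
    constructor mod
    field difference : + p ∣ℤ a ℤ.- b

  ≡⇒≈ : ∀ {a b} → a ≡ b → a ≈ b
  ≡⇒≈ {a} refl = mod (divides (+ 0) (ℤ.+-inverseʳ a))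

  ≈-refl : ∀ {a} → a ≈ a
  ≈-refl = ≡⇒≈ refl

  ≈-sym : ∀ {a b} → a ≈ b → b ≈ a
  ≈-sym {a} {b} (mod d) = mod (subst (+ p ∣ℤ_) (flip a b) (ℤ∣.∣m⇒∣-m d))
    where
    flip : ∀ a b → ℤ.- (a ℤ.- b) ≡ b ℤ.- a
    flip = solve-∀

  ≈-trans : ∀ {a b c} → a ≈ b → b ≈ c → a ≈ c
  ≈-trans {a} {b} {c} (mod d) (mod e) = mod (subst (+ p ∣ℤ_) (chain a b c) (ℤ∣.∣m∣n⇒∣m+n d e))
    where
    chain : ∀ a b c → (a ℤ.- b) ℤ.+ (b ℤ.- c) ≡ a ℤ.- c
    chain = solve-∀

  ≈-setoid : Setoid _ _
  ≈-setoid = record { Carrier = ℤ ; _≈_ = _≈_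
    ; isEquivalence = record { refl = ≈-refl ; sym = ≈-sym ; trans = ≈-trans } }

  module ≈-Reasoning where
    open import Relation.Binary.Reasoning.Setoid ≈-setoid public

  +-cong : ∀ {a b c d} → a ≈ b → c ≈ d → a ℤ.+ c ≈ b ℤ.+ d
  +-cong {a} {b} {c} {d} (mod x) (mod y) = mod (subst (+ p ∣ℤ_) (regroup a b c d) (ℤ∣.∣m∣n⇒∣m+n x y))
    where
    regroup : ∀ a b c d → (a ℤ.- b) ℤ.+ (c ℤ.- d) ≡ (a ℤ.+ c) ℤ.- (b ℤ.+ d)
    regroup = solve-∀

  neg-cong : ∀ {a b} → a ≈ b → ℤ.- a ≈ ℤ.- b
  neg-cong {a} {b} (mod x) = mod (subst (+ p ∣ℤ_) (regroup a b) (ℤ∣.∣m⇒∣-m x))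
    where
    regroup : ∀ a b → ℤ.- (a ℤ.- b) ≡ ℤ.- a ℤ.- (ℤ.- b)
    regroup = solve-∀

  *-cong : ∀ {a b c d} → a ≈ b → c ≈ d → a ℤ.* c ≈ b ℤ.* d
  *-cong {a} {b} {c} {d} (mod x) (mod y) =
    mod (subst (+ p ∣ℤ_) (regroup a b c d) (ℤ∣.∣m∣n⇒∣m+n (ℤ∣.∣m⇒∣m*n c x) (ℤ∣.∣n⇒∣m*n b y)))
    where
    regroup : ∀ a b c d → (a ℤ.- b) ℤ.* c ℤ.+ b ℤ.* (c ℤ.- d) ≡ a ℤ.* c ℤ.- b ℤ.* d
    regroup = solve-∀

  *-congˡ : ∀ a {b c} → b ≈ c → a ℤ.* b ≈ a ℤ.* c
  *-congˡ a = *-cong (≈-refl {a})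

  *-congʳ : ∀ a {b c} → b ≈ c → b ℤ.* a ≈ c ℤ.* a
  *-congʳ a e = *-cong e (≈-refl {a})

  ≈0⇒∣ : ∀ {a} → a ≈ + 0 → + p ∣ℤ a
  ≈0⇒∣ {a} (mod d) = subst (+ p ∣ℤ_) (ℤ.+-identityʳ a) d

  ∣⇒≈0 : ∀ {a} → + p ∣ℤ a → a ≈ + 0
  ∣⇒≈0 {a} d = mod (subst (+ p ∣ℤ_) (sym (ℤ.+-identityʳ a)) d)

  abstract
    _≈0? : ∀ a → Dec (a ≈ + 0)
    a ≈0? = map′ ∣⇒≈0 ≈0⇒∣ (+ p ℤ∣.∣? a)

  sub≈0⇒≈ : ∀ {a b} → a ℤ.- b ≈ + 0 → a ≈ b
  sub≈0⇒≈ e = mod (≈0⇒∣ e)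

  ≈⇒sub≈0 : ∀ {a b} → a ≈ b → a ℤ.- b ≈ + 0
  ≈⇒sub≈0 (mod d) = ∣⇒≈0 d

  abstract
    *≈0 : ∀ a b → a ℤ.* b ≈ + 0 → a ≈ + 0 ⊎ b ≈ + 0
    *≈0 a b e = Sum.map (∣⇒≈0 ∘ ℤ∣.∣ᵤ⇒∣) (∣⇒≈0 ∘ ℤ∣.∣ᵤ⇒∣)
      (euclidsLemma ℤ.∣ a ∣ ℤ.∣ b ∣ p-prime (subst (p ℕ∣.∣_) (ℤ.abs-* a b) (ℤ∣.∣⇒∣ᵤ (≈0⇒∣ e))))

  infix 4 _≉0
  _≉0 : ℤ → Set
  a ≉0 = ¬ (a ≈ + 0)

  *≉0 : ∀ {a b} → a ≉0 → b ≉0 → a ℤ.* b ≉0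
  *≉0 {a} {b} a≉0 b≉0 e = Sum.[ a≉0 , b≉0 ] (*≈0 a b e)

  ≉0-resp : ∀ {a b} → a ≈ b → a ≉0 → b ≉0
  ≉0-resp a≈b a≉0 b≈0 = a≉0 (≈-trans a≈b b≈0)

  *≈0ˡ : ∀ {a} b → a ≈ + 0 → a ℤ.* b ≈ + 0
  *≈0ˡ {a} b e = *-congʳ b e

  *≈0ʳ : ∀ a {b} → b ≈ + 0 → a ℤ.* b ≈ + 0
  *≈0ʳ a {b} e = ≈-trans (*-congˡ a e) (≡⇒≈ (ℤ.*-zeroʳ a))

  *≉0⇒≉0ˡ : ∀ {a} b → a ℤ.* b ≉0 → a ≉0
  *≉0⇒≉0ˡ b ab≉0 a≈0 = ab≉0 (*≈0ˡ b a≈0)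

  *-cancelˡ : ∀ a b c → a ≉0 → a ℤ.* b ≈ a ℤ.* c → b ≈ c
  *-cancelˡ a b c a≉0 e = sub≈0⇒≈ (Sum.[ (λ z → ⊥-elim (a≉0 z)) , (λ z → z) ]
    (*≈0 a (b ℤ.- c) (≈-trans (≡⇒≈ (distrib a b c)) (≈⇒sub≈0 e))))
    where
    distrib : ∀ a b c → a ℤ.* (b ℤ.- c) ≡ a ℤ.* b ℤ.- a ℤ.* c
    distrib = solve-∀

  sign*-inj : ∀ {e a b} → IsSign e → e ℤ.* a ≈ b → a ≈ e ℤ.* b
  sign*-inj {e} {a} {b} s h = begin
    a                  ≡⟨ ℤ.*-identityˡ a ⟨
    + 1 ℤ.* a          ≡⟨ cong (ℤ._* a) (sign²≡1 s) ⟨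
    e ℤ.* e ℤ.* a      ≡⟨ ℤ.*-assoc e e a ⟩
    e ℤ.* (e ℤ.* a)    ≈⟨ *-congˡ e h ⟩
    e ℤ.* b            ∎
    where open ≈-Reasoning

  abstract
    square-≈ : ∀ a b → a ℤ.* a ≈ b ℤ.* b → ∃ λ e → IsSign e × a ≈ e ℤ.* b
    square-≈ a b h = Sum.[ same , opposite-sign ]
      (*≈0 (a ℤ.- b) (a ℤ.+ b) (≈-trans (≡⇒≈ (factor a b)) (≈⇒sub≈0 h)))
      where
      factor : ∀ a b → (a ℤ.- b) ℤ.* (a ℤ.+ b) ≡ a ℤ.* a ℤ.- b ℤ.* b
      factor = solve-∀
      sub-neg : ∀ a b → a ℤ.- (ℤ.- b) ≡ a ℤ.+ b
      sub-neg = solve-∀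
      same : a ℤ.- b ≈ + 0 → ∃ λ e → IsSign e × a ≈ e ℤ.* b
      same e = + 1 , inj₁ refl , ≈-trans (sub≈0⇒≈ e) (≡⇒≈ (sym (ℤ.*-identityˡ b)))
      opposite-sign : a ℤ.+ b ≈ + 0 → ∃ λ e → IsSign e × a ≈ e ℤ.* b
      opposite-sign e = -[1+ 0 ] , inj₂ refl ,
        ≈-trans (sub≈0⇒≈ (≈-trans (≡⇒≈ (sub-neg a b)) e)) (≡⇒≈ (sym (ℤ.-1*i≡-i b)))

  small-≈ : ∀ {r s} → r < p → s < p → + r ≈ + s → r ≡ s
  small-≈ {r} {s} r<p s<p (mod d) = ℤ.+-injective (ℤ.i-j≡0⇒i≡j (+ r) (+ s) (ℤ.∣i∣≡0⇒i≡0 ∣r-s∣≡0))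
    where
    bound : ℤ.∣ + r ℤ.- + s ∣ < p
    bound = ℕ.≤-<-trans (subst (ℕ._≤ (r ℕ.⊔ s)) (cong ℤ.∣_∣ (sym (ℤ.m-n≡m⊖n r s))) (ℤ.∣m⊝n∣≤m⊔n r s)) (ℕ.⊔-lub r<p s<p)
    ∣r-s∣≡0 : ℤ.∣ + r ℤ.- + s ∣ ≡ 0
    ∣r-s∣≡0 with ℤ.∣ + r ℤ.- + s ∣ | bound | ℤ∣.∣⇒∣ᵤ d
    ... | zero | _ | _ = refl
    ... | suc k | lt | p∣ = ⊥-elim (ℕ∣.>⇒∤ lt p∣)

  ≈-%ℕ : ∀ z → z ≈ + (z %ℕ p)
  ≈-%ℕ z = mod (divides (z /ℕ p) (trans (cong (ℤ._- + (z %ℕ p)) (a≡a%ℕn+[a/ℕn]*n z p)) (cancel (+ (z %ℕ p)) _)))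
    where
    cancel : ∀ a b → a ℤ.+ b ℤ.- a ≡ b
    cancel = solve-∀

  -- Fin n stands for the half system {1, …, n}, that is, for F_p^* / ±1.
  ι : Fin n → ℤ
  ι x = + suc (toℕ x)

  abstract
    0<n : 0 < n
    0<n = ℕ.n≢0⇒n>0 λ n≡0 → not-prime-1 (subst Prime (trans p≡1+2n (cong (λ k → suc (k ℕ.+ k)) n≡0)) p-prime)
      where
      not-prime-1 : ¬ Prime 1
      not-prime-1 pr with prime⇒nonTrivial pr
      ... | ()

  one : Fin n
  one = fromℕ< 0<n

  ι-one : ι one ≡ + 1
  ι-one = cong (+_ ∘ suc) (Fin.toℕ-fromℕ< 0<n)

  ι<p : ∀ x → suc (toℕ x) < p
  ι<p x = subst (suc (toℕ x) <_) (sym p≡1+2n) (s≤s (ℕ.≤-trans (Fin.toℕ<n x) (ℕ.m≤m+n n n)))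

  0<p : 0 < p
  0<p = subst (0 <_) (sym p≡1+2n) (s≤s z≤n)

  abstract
    ι≉0 : ∀ x → ι x ≉0
    ι≉0 x e with small-≈ (ι<p x) 0<p e
    ... | ()

  abstract
    1≉0 : + 1 ≉0
    1≉0 = subst _≉0 ι-one (ι≉0 one)

  sign≉0 : ∀ {e} → IsSign e → e ≉0
  sign≉0 (inj₁ refl) = 1≉0
  sign≉0 (inj₂ refl) = 1≉0 ∘ neg-cong

  abstract
    ι-+≉0 : ∀ x y → ι x ℤ.+ ι y ≉0
    ι-+≉0 x y e with small-≈ (subst (suc (toℕ x) ℕ.+ suc (toℕ y) <_) (sym p≡1+2n)
                                (s≤s (ℕ.+-mono-≤ (Fin.toℕ<n x) (Fin.toℕ<n y)))) 0<p e
    ... | ()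

  abstract
    -- With equal signs two numbers between 0 and p are congruent; with opposite signs x + y, which
    -- lies between 2 and 2n = p - 1, would be divisible by p.
    signed-unique : ∀ {d e x y} → IsSign d → IsSign e → d ℤ.* ι x ≈ e ℤ.* ι y → d ≡ e × x ≡ y
    signed-unique {x = x} {y} (inj₁ refl) (inj₁ refl) h = refl ,
      Fin.toℕ-injective (ℕ.suc-injective (small-≈ (ι<p x) (ι<p y)
        (≈-trans (≡⇒≈ (sym (ℤ.*-identityˡ (ι x)))) (≈-trans h (≡⇒≈ (ℤ.*-identityˡ (ι y)))))))
    signed-unique {x = x} {y} (inj₂ refl) (inj₂ refl) h = refl ,
      proj₂ (signed-unique (inj₁ refl) (inj₁ refl) (≈-trans (≡⇒≈ (flip (ι x))) (≈-trans (neg-cong h) (≡⇒≈ (sym (flip (ι y)))))))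
      where
      flip : ∀ a → + 1 ℤ.* a ≡ ℤ.- (-[1+ 0 ] ℤ.* a)
      flip = solve-∀
    signed-unique {x = x} {y} (inj₁ refl) (inj₂ refl) h = ⊥-elim (ι-+≉0 x y
      (≈-trans (≡⇒≈ (move (ι x) (ι y))) (≈⇒sub≈0 h)))
      where
      move : ∀ a b → a ℤ.+ b ≡ + 1 ℤ.* a ℤ.- -[1+ 0 ] ℤ.* b
      move = solve-∀
    signed-unique {x = x} {y} (inj₂ refl) (inj₁ refl) h = ⊥-elim (ι-+≉0 y x
      (≈-trans (≡⇒≈ (move (ι y) (ι x))) (≈⇒sub≈0 (≈-sym h))))
      where
      move : ∀ a b → a ℤ.+ b ≡ + 1 ℤ.* a ℤ.- -[1+ 0 ] ℤ.* b
      move = solve-∀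

  record Balanced (z : ℤ) : Set where
    field
      representative : Fin n
      coefficient    : ℤ
      isSign         : IsSign coefficient
      congruent      : z ≈ coefficient ℤ.* ι representative
      tilde≡         : tilde p z ≡ suc (toℕ representative)

  p≈0 : + p ≈ + 0
  p≈0 = ∣⇒≈0 ℤ∣.∣-refl

  -- A residue r > p/2 is -(p - r) modulo p. So the case split of `tilde` is the choice of the sign,
  -- and its value is the representative in 1, ..., n.
  balanced : ∀ z → z ≉0 → Balanced z
  balanced z z≉0 with p ℕ.<? 2 ℕ.* (z %ℕ p)
  ... | yes p<2r = record
    { representative = fromℕ< t<n ; coefficient = -[1+ 0 ] ; isSign = inj₂ refl
    ; congruent = begin
        z                      ≈⟨ ≈-%ℕ z ⟩
        + r                    ≡⟨ rearrange (+ r) (+ p) ⟩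
        + p ℤ.+ -[1+ 0 ] ℤ.* (+ p ℤ.- + r)
                               ≈⟨ +-cong p≈0 (≈-refl { -[1+ 0 ] ℤ.* (+ p ℤ.- + r) }) ⟩
        + 0 ℤ.+ -[1+ 0 ] ℤ.* (+ p ℤ.- + r)
                               ≡⟨ ℤ.+-identityˡ _ ⟩
        -[1+ 0 ] ℤ.* (+ p ℤ.- + r)
                               ≡⟨ cong (-[1+ 0 ] ℤ.*_) (trans (ℤ.m-n≡m⊖n p r) (ℤ.⊖-≥ r≤p)) ⟩
        -[1+ 0 ] ℤ.* + (p ℕ.∸ r)
                               ≡⟨ cong (λ k → -[1+ 0 ] ℤ.* + k) t≡ ⟩
        -[1+ 0 ] ℤ.* + suc (toℕ (fromℕ< t<n)) ∎
    ; tilde≡ = trans tilde-high t≡ }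
    where
    open ≈-Reasoning
    r = z %ℕ p
    r≤p = ℕ.<⇒≤ (n%ℕd<d z p)
    rearrange : ∀ a b → a ≡ b ℤ.+ -[1+ 0 ] ℤ.* (b ℤ.- a)
    rearrange = solve-∀
    tilde-high : tilde p z ≡ p ℕ.∸ r
    tilde-high with p ℕ.<? 2 ℕ.* (z %ℕ p)
    ... | yes _ = refl
    ... | no ¬lt = contradiction p<2r ¬lt
    t>0 : 0 < p ℕ.∸ r
    t>0 = ℕ.m<n⇒0<n∸m (n%ℕd<d z p)
    suc-pred : suc (p ℕ.∸ r ℕ.∸ 1) ≡ p ℕ.∸ r
    suc-pred = ℕ.m+[n∸m]≡n t>0
    n<r : n < r
    n<r = ℕ.≰⇒> λ r≤n → ℕ.<⇒≱ p<2r (ℕ.≤-trans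
      (ℕ.+-mono-≤ r≤n (subst (ℕ._≤ n) (sym (ℕ.+-identityʳ r)) r≤n))
      (subst (n ℕ.+ n ≤_) (sym p≡1+2n) (ℕ.n≤1+n _)))
    t≤n : p ℕ.∸ r ≤ n
    t≤n = ℕ.≤-trans (ℕ.∸-monoʳ-≤ p n<r)
      (ℕ.≤-reflexive (trans (cong (ℕ._∸ suc n) p≡1+2n) (ℕ.m+n∸m≡n n n)))
    t<n : p ℕ.∸ r ℕ.∸ 1 < n
    t<n = subst (ℕ._≤ n) (sym suc-pred) t≤n
    t≡ : p ℕ.∸ r ≡ suc (toℕ (fromℕ< t<n))
    t≡ = trans (sym suc-pred) (cong suc (sym (Fin.toℕ-fromℕ< t<n)))
  ... | no p≮2r = record
    { representative = fromℕ< t<n ; coefficient = + 1 ; isSign = inj₁ refl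
    ; congruent = ≈-trans (≈-%ℕ z) (≡⇒≈ (trans (cong +_ t≡) (sym (ℤ.*-identityˡ _))))
    ; tilde≡ = trans tilde-low t≡ }
    where
    r = z %ℕ p
    tilde-low : tilde p z ≡ r
    tilde-low with p ℕ.<? 2 ℕ.* (z %ℕ p)
    ... | yes lt = contradiction lt p≮2r
    ... | no _ = refl
    r>0 : 0 < r
    r>0 = ℕ.n≢0⇒n>0 λ r≡0 → z≉0 (≈-trans (≈-%ℕ z) (≡⇒≈ (cong +_ r≡0)))
    suc-pred : suc (r ℕ.∸ 1) ≡ r
    suc-pred = ℕ.m+[n∸m]≡n r>0
    r≤n : r ≤ n
    r≤n = ℕ.≮⇒≥ λ n<r → p≮2r (subst (_< 2 ℕ.* r) (sym p≡1+2n)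
      (ℕ.≤-trans (ℕ.≤-reflexive (cong suc (sym (ℕ.+-suc n n))))
        (ℕ.+-mono-≤ n<r (subst (n <_) (sym (ℕ.+-identityʳ r)) n<r))))
    t<n : r ℕ.∸ 1 < n
    t<n = subst (ℕ._≤ n) (sym suc-pred) r≤n
    t≡ : r ≡ suc (toℕ (fromℕ< t<n))
    t≡ = trans (sym suc-pred) (cong suc (sym (Fin.toℕ-fromℕ< t<n)))

  -- ε z is the sign of the residue of z of least absolute value, and cls z the
  -- class of z in F_p^* / ±1; multiples of p get the junk values 0 and one.
  abstract
    ε : ℤ → ℤ
    ε z with z ≈0?
    ... | yes _ = + 0
    ... | no z≉0 = Balanced.coefficient (balanced z z≉0)

    cls : ℤ → Fin n
    cls z with z ≈0?
    ... | yes _ = one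
    ... | no z≉0 = Balanced.representative (balanced z z≉0)

    ε≈0 : ∀ {z} → z ≈ + 0 → ε z ≡ + 0
    ε≈0 {z} z≈0 with z ≈0?
    ... | yes _ = refl
    ... | no z≉0 = contradiction z≈0 z≉0

    ε-sign : ∀ {z} → z ≉0 → IsSign (ε z)
    ε-sign {z} z≉0 with z ≈0?
    ... | yes z≈0 = contradiction z≈0 z≉0
    ... | no z≉0 = Balanced.isSign (balanced z z≉0)

    ε-cls : ∀ {z} → z ≉0 → z ≈ ε z ℤ.* ι (cls z)
    ε-cls {z} z≉0 with z ≈0?
    ... | yes z≈0 = contradiction z≈0 z≉0
    ... | no z≉0 = Balanced.congruent (balanced z z≉0)

    tilde-cls : ∀ {z} → z ≉0 → tilde p z ≡ suc (toℕ (cls z))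
    tilde-cls {z} z≉0 with z ≈0?
    ... | yes z≈0 = contradiction z≈0 z≉0
    ... | no z≉0 = Balanced.tilde≡ (balanced z z≉0)

  ε-cls-unique : ∀ {z e x} → IsSign e → z ≈ e ℤ.* ι x → ε z ≡ e × cls z ≡ x
  ε-cls-unique {z} {e} {x} s h = signed-unique (ε-sign z≉0) s (≈-trans (≈-sym (ε-cls z≉0)) h)
    where z≉0 = ≉0-resp (≈-sym h) (*≉0 (sign≉0 s) (ι≉0 x))

  ε-ι : ∀ x → ε (ι x) ≡ + 1
  ε-ι x = proj₁ (ε-cls-unique (inj₁ refl) (≡⇒≈ (sym (ℤ.*-identityˡ (ι x)))))

  cls-ι : ∀ x → cls (ι x) ≡ x
  cls-ι x = proj₂ (ε-cls-unique (inj₁ refl) (≡⇒≈ (sym (ℤ.*-identityˡ (ι x)))))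

  ε-sign-* : ∀ {e z w} → IsSign e → w ≈ e ℤ.* z → ε w ≡ e ℤ.* ε z
  ε-sign-* {e} {z} {w} s h with z ≈0?
  ... | yes z≈0 = trans (ε≈0 (≈-trans h (*≈0ʳ e z≈0))) (sym (trans (cong (e ℤ.*_) (ε≈0 z≈0)) (ℤ.*-zeroʳ e)))
  ... | no z≉0 = proj₁ (ε-cls-unique (isSign-* s (ε-sign z≉0))
      (≈-trans h (≈-trans (*-congˡ e (ε-cls z≉0)) (≡⇒≈ (sym (ℤ.*-assoc e (ε z) _))))))

  cls-sign-* : ∀ {e z w} → z ≉0 → IsSign e → w ≈ e ℤ.* z → cls w ≡ cls z
  cls-sign-* {e} {z} {w} z≉0 s h = proj₂ (ε-cls-unique (isSign-* s (ε-sign z≉0))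
      (≈-trans h (≈-trans (*-congˡ e (ε-cls z≉0)) (≡⇒≈ (sym (ℤ.*-assoc e (ε z) _))))))

  ε-cong : ∀ {z w} → w ≈ z → ε w ≡ ε z
  ε-cong {z} h = trans (ε-sign-* (inj₁ refl) (≈-trans h (≡⇒≈ (sym (ℤ.*-identityˡ z))))) (ℤ.*-identityˡ (ε z))

  cls-cong : ∀ {z w} → z ≉0 → w ≈ z → cls w ≡ cls z
  cls-cong {z} z≉0 h = cls-sign-* z≉0 (inj₁ refl) (≈-trans h (≡⇒≈ (sym (ℤ.*-identityˡ z))))

  abstract
    cls-≡⇒≈ : ∀ {z w} → z ≉0 → w ≉0 → cls z ≡ cls w → ∃ λ e → IsSign e × z ≈ e ℤ.* w
    cls-≡⇒≈ {z} {w} z≉0 w≉0 h = ε z ℤ.* ε w , isSign-* (ε-sign z≉0) (ε-sign w≉0) , (begin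
      z                                    ≈⟨ ε-cls z≉0 ⟩
      ε z ℤ.* ι (cls z)                    ≡⟨ cong (λ x → ε z ℤ.* ι x) h ⟩
      ε z ℤ.* ι (cls w)                    ≈⟨ *-congˡ (ε z) (sign*-inj (ε-sign w≉0) (≈-sym (ε-cls w≉0))) ⟩
      ε z ℤ.* (ε w ℤ.* w)                  ≡⟨ ℤ.*-assoc (ε z) (ε w) w ⟨
      ε z ℤ.* ε w ℤ.* w                    ∎)
      where open ≈-Reasoning

  -- Multiplication on classes and the quadratic character

  act : ℤ → Fin n → Fin n
  act a x = cls (a ℤ.* ι x)

  act-injective : ∀ {a} → a ≉0 → Injective _≡_ _≡_ (act a)
  act-injective {a} a≉0 {x} {y} h with cls-≡⇒≈ (*≉0 a≉0 (ι≉0 x)) (*≉0 a≉0 (ι≉0 y)) h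
  ... | e , s , ax≈eay = proj₂ (signed-unique (inj₁ refl) s
    (≈-trans (≡⇒≈ (ℤ.*-identityˡ (ι x))) (*-cancelˡ a (ι x) (e ℤ.* ι y) a≉0 (≈-trans ax≈eay (≡⇒≈ (swap e a (ι y)))))))
    where
    swap : ∀ e a b → e ℤ.* (a ℤ.* b) ≡ a ℤ.* (e ℤ.* b)
    swap = solve-∀

  act-cls : ∀ {a z} → a ≉0 → z ≉0 → act a (cls z) ≡ cls (a ℤ.* z)
  act-cls {a} {z} a≉0 z≉0 = cls-sign-* (*≉0 a≉0 z≉0) (ε-sign z≉0) (begin
    a ℤ.* ι (cls z)       ≈⟨ *-congˡ a (sign*-inj (ε-sign z≉0) (≈-sym (ε-cls z≉0))) ⟩
    a ℤ.* (ε z ℤ.* z)     ≡⟨ swap a (ε z) z ⟩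
    ε z ℤ.* (a ℤ.* z)     ∎)
    where
    open ≈-Reasoning
    swap : ∀ a e z → a ℤ.* (e ℤ.* z) ≡ e ℤ.* (a ℤ.* z)
    swap = solve-∀

  -- By Gauss's lemma this is the Legendre symbol.
  χ : ℤ → ℤ
  χ a = Π.sum (λ x → ε (a ℤ.* ι x))

  χ-cong : ∀ {a b} → a ≈ b → χ a ≡ χ b
  χ-cong h = Π.sum-cong-≗ (λ x → ε-cong (*-congʳ (ι x) h))

  χ≈0 : ∀ {a} → a ≈ + 0 → χ a ≡ + 0
  χ≈0 h = Π-zero one (ε≈0 (*≈0ˡ (ι one) h))

  χ-sign : ∀ {a} → a ≉0 → IsSign (χ a)
  χ-sign h = isSign-Π (λ x → ε-sign (*≉0 h (ι≉0 x)))

  -- The classes of the values f x run once through all classes, so splitting off the signs ε(f x)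
  -- leaves a rearrangement of χ(a). With f x = b x this is multiplicativity; with f x = 1 / x it
  -- evaluates χ at a nonsquare.
  χ-factor : ∀ {f : Fin n → ℤ} → (∀ x → f x ≉0) → Injective _≡_ _≡_ (cls ∘ f) → ∀ a →
             Π.sum (λ x → ε (a ℤ.* f x)) ≡ χ a ℤ.* Π.sum (ε ∘ f)
  χ-factor {f} f≉0 inj a = begin
    Π.sum (λ x → ε (a ℤ.* f x))
      ≡⟨ Π.sum-cong-≗ (λ x → trans (ε-sign-* (ε-sign (f≉0 x)) (factor x)) (ℤ.*-comm (ε (f x)) (ε (a ℤ.* ι (cls (f x)))))) ⟩
    Π.sum (λ x → ε (a ℤ.* ι (cls (f x))) ℤ.* ε (f x))
      ≡⟨ Π.∑-distrib-+ (λ x → ε (a ℤ.* ι (cls (f x)))) (ε ∘ f) ⟩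
    Π.sum (λ x → ε (a ℤ.* ι (cls (f x)))) ℤ.* Π.sum (ε ∘ f)
      ≡⟨ cong (ℤ._* Π.sum (ε ∘ f)) (Π.sum-reindex inj (λ x → ε (a ℤ.* ι x))) ⟨
    χ a ℤ.* Π.sum (ε ∘ f) ∎
    where
    open ≡-Reasoning
    swap : ∀ a e z → a ℤ.* (e ℤ.* z) ≡ e ℤ.* (a ℤ.* z)
    swap = solve-∀
    factor : ∀ x → a ℤ.* f x ≈ ε (f x) ℤ.* (a ℤ.* ι (cls (f x)))
    factor x = ≈-trans (*-congˡ a (ε-cls (f≉0 x))) (≡⇒≈ (swap a (ε (f x)) (ι (cls (f x)))))

  χ-* : ∀ a b → χ (a ℤ.* b) ≡ χ a ℤ.* χ b
  χ-* a b with b ≈0?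
  ... | yes b≈0 = trans (χ≈0 (*≈0ʳ a b≈0)) (sym (trans (cong (χ a ℤ.*_) (χ≈0 b≈0)) (ℤ.*-zeroʳ (χ a))))
  ... | no b≉0 = trans (Π.sum-cong-≗ (λ x → cong ε (ℤ.*-assoc a b (ι x))))
      (χ-factor (λ x → *≉0 b≉0 (ι≉0 x)) (act-injective b≉0) a)

  χ-1 : χ (+ 1) ≡ + 1
  χ-1 = Π.sum-neutral (λ x → trans (cong ε (ℤ.*-identityˡ (ι x))) (ε-ι x))

  χ-square : ∀ {a} → a ≉0 → χ (a ℤ.* a) ≡ + 1
  χ-square {a} a≉0 = trans (χ-* a a) (sign²≡1 {χ a} (χ-sign a≉0))

  χ-square-* : ∀ {a} b → a ≉0 → χ (a ℤ.* a ℤ.* b) ≡ χ b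
  χ-square-* {a} b a≉0 = trans (χ-* (a ℤ.* a) b) (trans (cong (ℤ._* χ b) (χ-square {a} a≉0)) (ℤ.*-identityˡ (χ b)))

  abstract
    -- Multiplication by `a` is injective on the finite set of classes, so it reaches the class of
    -- 1; the sign that remains is absorbed.
    invert : ∀ a → a ≉0 → ∃ λ b → b ℤ.* a ≈ + 1
    invert a a≉0 =
      let x , h = injective⇒surjective (act-injective a≉0) (cls (+ 1))
          e , s , ax≈e = cls-≡⇒≈ (*≉0 a≉0 (ι≉0 x)) 1≉0 h
      in e ℤ.* ι x , (begin
        e ℤ.* ι x ℤ.* a       ≡⟨ swap e (ι x) a ⟩
        e ℤ.* (a ℤ.* ι x)     ≈⟨ *-congˡ e ax≈e ⟩
        e ℤ.* (e ℤ.* + 1)     ≡⟨ cong (e ℤ.*_) (ℤ.*-identityʳ e) ⟩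
        e ℤ.* e               ≡⟨ sign²≡1 s ⟩
        + 1                   ∎)
      where
      open ≈-Reasoning
      swap : ∀ e x a → e ℤ.* x ℤ.* a ≡ e ℤ.* (a ℤ.* x)
      swap = solve-∀

  abstract
    -- The value 0 at multiples of p keeps `inv` injective modulo p on all integers, as the
    -- substitution in the Jacobsthal sum requires.
    inv : ℤ → ℤ
    inv a with a ≈0?
    ... | yes _ = + 0
    ... | no a≉0 = proj₁ (invert a a≉0)

    inv-* : ∀ {a} → a ≉0 → inv a ℤ.* a ≈ + 1
    inv-* {a} a≉0 with a ≈0?
    ... | yes a≈0 = contradiction a≈0 a≉0
    ... | no a≉0 = proj₂ (invert a a≉0)

    inv≈0 : ∀ {a} → a ≈ + 0 → inv a ≈ + 0
    inv≈0 {a} a≈0 with a ≈0?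
    ... | yes _ = ≈-refl
    ... | no a≉0 = contradiction a≈0 a≉0

  inv≉0 : ∀ {a} → a ≉0 → inv a ≉0
  inv≉0 {a} a≉0 = *≉0⇒≉0ˡ {inv a} a (≉0-resp (≈-sym (inv-* a≉0)) 1≉0)

  inv-unique : ∀ {a b} → b ℤ.* a ≈ + 1 → inv a ≈ b
  inv-unique {a} {b} h = *-cancelˡ a (inv a) b a≉0 (≈-trans (≡⇒≈ (ℤ.*-comm a (inv a))) (≈-trans (inv-* a≉0)
      (≈-trans (≈-sym h) (≡⇒≈ (ℤ.*-comm b a)))))
    where
    a≉0 : a ≉0
    a≉0 a≈0 = 1≉0 (≈-trans (≈-sym h) (*≈0ʳ b a≈0))

  -- Halving modulo p and the sign of a difference

  half : ℤ
  half = + suc n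

  half-double : half ℤ.+ half ≈ + 1
  half-double = begin
    half ℤ.+ half                        ≡⟨ cong (+_ ∘ suc) (ℕ.+-suc n n) ⟩
    + 1 ℤ.+ + suc (n ℕ.+ n)              ≡⟨ cong (λ k → + 1 ℤ.+ + k) p≡1+2n ⟨
    + 1 ℤ.+ + p                          ≈⟨ +-cong (≈-refl {+ 1}) p≈0 ⟩
    + 1                                  ∎
    where open ≈-Reasoning

  half-* : ∀ a → half ℤ.* (a ℤ.+ a) ≈ a
  half-* a = ≈-trans (≡⇒≈ (expand half a)) (≈-trans (*-congʳ a half-double) (≡⇒≈ (ℤ.*-identityˡ a)))
    where
    expand : ∀ h a → h ℤ.* (a ℤ.+ a) ≡ (h ℤ.+ h) ℤ.* a
    expand = solve-∀

  half≉0 : half ≉0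
  half≉0 h = 1≉0 (≈-trans (≈-sym half-double) (+-cong h h))

  double-≤ : ∀ {w} → w ℕ.+ w ≤ n ℕ.+ n → w ≤ n
  double-≤ le = ℕ.≮⇒≥ λ n<w → ℕ.<⇒≱ (ℕ.+-mono-< n<w n<w) le

  -- Halving d modulo p keeps it in {1, …, n} exactly when d is even.
  ε-half : ∀ d → 0 < d → d ≤ n ℕ.+ n → ε (half ℤ.* + d) ≡ alt d
  ε-half d 0<d d≤2n with even⊎odd d
  ... | zero , inj₁ refl = contradiction 0<d λ ()
  ... | suc w , inj₁ refl = trans
      (proj₁ (ε-cls-unique {x = fromℕ< w<n} (inj₁ refl) (≈-trans (half-* (+ suc w))
        (≡⇒≈ (trans (cong (+_ ∘ suc) (sym (Fin.toℕ-fromℕ< w<n))) (sym (ℤ.*-identityˡ _)))))))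
      (sym (alt-double (suc w)))
    where w<n = double-≤ d≤2n
  -- Half of 2w + 1 is w + n + 1 = p - (n - w), so the sign is -1 and the representative n - w,
  -- written `suc r`.
  ... | w , inj₂ refl = trans
      (proj₁ (ε-cls-unique {x = fromℕ< r<n} (inj₂ refl) (begin
        half ℤ.* + suc (w ℕ.+ w)                 ≡⟨ expand half (+ w) ⟩
        half ℤ.* (+ w ℤ.+ + w) ℤ.+ half          ≈⟨ +-cong (half-* (+ w)) (≈-refl {half}) ⟩
        + w ℤ.+ half                             ≡⟨ cong (λ k → + w ℤ.+ + suc k) n≡ ⟩
        + w ℤ.+ + suc (w ℕ.+ suc r)              ≡⟨ rearrange (+ w) (+ r) ⟩
        + suc ((w ℕ.+ suc r) ℕ.+ (w ℕ.+ suc r)) ℤ.+ -[1+ 0 ] ℤ.* + suc r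
          ≡⟨ cong₂ (λ k l → + suc (k ℕ.+ k) ℤ.+ -[1+ 0 ] ℤ.* + suc l) n≡ (Fin.toℕ-fromℕ< r<n) ⟨
        + suc (n ℕ.+ n) ℤ.+ -[1+ 0 ] ℤ.* ι (fromℕ< r<n)
          ≡⟨ cong (λ k → + k ℤ.+ -[1+ 0 ] ℤ.* ι (fromℕ< r<n)) p≡1+2n ⟨
        + p ℤ.+ -[1+ 0 ] ℤ.* ι (fromℕ< r<n)
          ≈⟨ +-cong p≈0 (≈-refl { -[1+ 0 ] ℤ.* ι (fromℕ< r<n) }) ⟩
        + 0 ℤ.+ -[1+ 0 ] ℤ.* ι (fromℕ< r<n)
          ≡⟨ ℤ.+-identityˡ _ ⟩
        -[1+ 0 ] ℤ.* ι (fromℕ< r<n) ∎)))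
      (sym (cong ℤ.-_ (alt-double w)))
    where
    open ≈-Reasoning
    w<n : w < n
    w<n = ℕ.≰⇒> λ n≤w → ℕ.<⇒≱ d≤2n (ℕ.+-mono-≤ n≤w n≤w)
    r = n ℕ.∸ suc w
    n≡ : n ≡ w ℕ.+ suc r
    n≡ = trans (sym (ℕ.m+[n∸m]≡n w<n)) (sym (ℕ.+-suc w r))
    r<n : r < n
    r<n = subst (r <_) (sym n≡) (ℕ.m≤n+m (suc r) w)
    expand : ∀ h w → h ℤ.* (+ 1 ℤ.+ (w ℤ.+ w)) ≡ h ℤ.* (w ℤ.+ w) ℤ.+ h
    expand = solve-∀
    rearrange : ∀ w r → w ℤ.+ (+ 1 ℤ.+ (w ℤ.+ (+ 1 ℤ.+ r))) ≡
      (+ 1 ℤ.+ ((w ℤ.+ (+ 1 ℤ.+ r)) ℤ.+ (w ℤ.+ (+ 1 ℤ.+ r)))) ℤ.+ -[1+ 0 ] ℤ.* (+ 1 ℤ.+ r)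
    rearrange = solve-∀

  εε : ℤ → ℤ → ℤ
  εε a b = ε (half ℤ.* (a ℤ.- b)) ℤ.* ε (half ℤ.* (a ℤ.+ b))

  εε-swap : ∀ a b → εε a b ≡ ℤ.- εε b a
  εε-swap a b = begin
    ε (half ℤ.* (a ℤ.- b)) ℤ.* ε (half ℤ.* (a ℤ.+ b))
      ≡⟨ cong₂ ℤ._*_ (ε-sign-* (inj₂ refl) (≡⇒≈ (flip half a b))) (cong (λ s → ε (half ℤ.* s)) (ℤ.+-comm a b)) ⟩
    -[1+ 0 ] ℤ.* ε (half ℤ.* (b ℤ.- a)) ℤ.* ε (half ℤ.* (b ℤ.+ a))
      ≡⟨ -1* (ε (half ℤ.* (b ℤ.- a))) (ε (half ℤ.* (b ℤ.+ a))) ⟩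
    ℤ.- (ε (half ℤ.* (b ℤ.- a)) ℤ.* ε (half ℤ.* (b ℤ.+ a))) ∎
    where
    open ≡-Reasoning
    flip : ∀ h a b → h ℤ.* (a ℤ.- b) ≡ -[1+ 0 ] ℤ.* (h ℤ.* (b ℤ.- a))
    flip = solve-∀
    -1* : ∀ a b → -[1+ 0 ] ℤ.* a ℤ.* b ≡ ℤ.- (a ℤ.* b)
    -1* = solve-∀

  -- For x > y the numbers x - y and x + y have the same parity and lie in 1, ..., 2n, and there the
  -- sign of a half depends on the parity alone. Without halving, x + y may exceed n and spoil the
  -- sign.
  sgn-ι-> : ∀ x y → toℕ y < toℕ x → εε (ι x) (ι y) ≡ + 1
  sgn-ι-> x y y<x = begin
    ε (half ℤ.* (ι x ℤ.- ι y)) ℤ.* ε (half ℤ.* (ι x ℤ.+ ι y))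
      ≡⟨ cong₂ (λ a b → ε (half ℤ.* a) ℤ.* ε (half ℤ.* b)) difference sum ⟩
    ε (half ℤ.* + d) ℤ.* ε (half ℤ.* + (d ℕ.+ (t ℕ.+ t)))
      ≡⟨ cong₂ ℤ._*_ (ε-half d d>0 (ℕ.≤-trans (ℕ.m≤m+n d (t ℕ.+ t)) d+2t≤2n))
                     (ε-half (d ℕ.+ (t ℕ.+ t)) (ℕ.≤-trans d>0 (ℕ.m≤m+n d (t ℕ.+ t))) d+2t≤2n) ⟩
    alt d ℤ.* alt (d ℕ.+ (t ℕ.+ t))
      ≡⟨ cong (alt d ℤ.*_) (trans (alt-+ d (t ℕ.+ t)) (cong (alt d ℤ.*_) (alt-double t))) ⟩
    alt d ℤ.* (alt d ℤ.* + 1)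
      ≡⟨ cong (alt d ℤ.*_) (ℤ.*-identityʳ (alt d)) ⟩
    alt d ℤ.* alt d
      ≡⟨ sign²≡1 (alt-sign d) ⟩
    + 1 ∎
    where
    open ≡-Reasoning
    t = suc (toℕ y)
    d = toℕ x ℕ.∸ toℕ y
    d>0 : 0 < d
    d>0 = ℕ.m<n⇒0<n∸m y<x
    x≡ : suc (toℕ x) ≡ d ℕ.+ t
    x≡ = trans (cong suc (sym (ℕ.m∸n+n≡m (ℕ.<⇒≤ y<x)))) (sym (ℕ.+-suc d (toℕ y)))
    sum : ι x ℤ.+ ι y ≡ + (d ℕ.+ (t ℕ.+ t))
    sum = trans (cong (λ k → + k ℤ.+ ι y) x≡) (cong +_ (ℕ.+-assoc d t t))
    cancel : ∀ a b → a ℤ.+ b ℤ.- b ≡ a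
    cancel = solve-∀
    difference : ι x ℤ.- ι y ≡ + d
    difference = trans (cong (λ k → + k ℤ.- ι y) x≡) (cancel (+ d) (ι y))
    d+2t≤2n : d ℕ.+ (t ℕ.+ t) ≤ n ℕ.+ n
    d+2t≤2n = subst (ℕ._≤ n ℕ.+ n) (trans (cong (ℕ._+ t) x≡) (ℕ.+-assoc d t t)) (ℕ.+-mono-≤ (Fin.toℕ<n x) (Fin.toℕ<n y))

  sgn-ι : ∀ x y → sgn (toℕ x) (toℕ y) ≡ εε (ι x) (ι y)
  sgn-ι x y with ℕ.<-cmp (toℕ x) (toℕ y)
  ... | tri< lt _ _ = sym (trans (εε-swap (ι x) (ι y)) (cong ℤ.-_ (sgn-ι-> y x lt)))
  ... | tri≈ _ eq _ = sym (cong (ℤ._* ε (half ℤ.* (ι x ℤ.+ ι y)))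
      (ε≈0 (*≈0ʳ half (≈⇒sub≈0 (≡⇒≈ (cong (+_ ∘ suc) eq))))))
  ... | tri> _ _ gt = sym (sgn-ι-> x y gt)

  -- `εε z y` is even in z: replacing z by -z exchanges the two halves up to sign, and the signs
  -- cancel. So the representative of a class may be replaced by any member, in particular by a
  -- product c x.
  sgn-cls : ∀ {z} → z ≉0 → ∀ y → sgn (toℕ (cls z)) (toℕ y) ≡ εε z (ι y)
  sgn-cls {z} z≉0 y = trans (sgn-ι (cls z) y) (by-sign (ε-sign z≉0) (sign*-inj (ε-sign z≉0) (≈-sym (ε-cls z≉0))))
    where
    open ≡-Reasoning
    by-sign : ∀ {e c} → IsSign e → c ≈ e ℤ.* z → εε c (ι y) ≡ εε z (ι y)
    by-sign {c = c} (inj₁ refl) h = cong₂ ℤ._*_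
      (ε-cong (*-congˡ half (+-cong c≈z (≈-refl {ℤ.- ι y})))) (ε-cong (*-congˡ half (+-cong c≈z (≈-refl {ι y}))))
      where c≈z = ≈-trans h (≡⇒≈ (ℤ.*-identityˡ z))
    by-sign {c = c} (inj₂ refl) h = begin
      ε (half ℤ.* (c ℤ.- ι y)) ℤ.* ε (half ℤ.* (c ℤ.+ ι y))
        ≡⟨ cong₂ ℤ._*_
             (ε-sign-* (inj₂ refl) (≈-trans (*-congˡ half (+-cong h (≈-refl {ℤ.- ι y}))) (≡⇒≈ (flip₁ half z (ι y)))))
             (ε-sign-* (inj₂ refl) (≈-trans (*-congˡ half (+-cong h (≈-refl {ι y}))) (≡⇒≈ (flip₂ half z (ι y))))) ⟩
      -[1+ 0 ] ℤ.* ε (half ℤ.* (z ℤ.+ ι y)) ℤ.* (-[1+ 0 ] ℤ.* ε (half ℤ.* (z ℤ.- ι y)))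
        ≡⟨ signs (ε (half ℤ.* (z ℤ.+ ι y))) (ε (half ℤ.* (z ℤ.- ι y))) ⟩
      ε (half ℤ.* (z ℤ.- ι y)) ℤ.* ε (half ℤ.* (z ℤ.+ ι y)) ∎
      where
      flip₁ : ∀ h z y → h ℤ.* (-[1+ 0 ] ℤ.* z ℤ.- y) ≡ -[1+ 0 ] ℤ.* (h ℤ.* (z ℤ.+ y))
      flip₁ = solve-∀
      flip₂ : ∀ h z y → h ℤ.* (-[1+ 0 ] ℤ.* z ℤ.+ y) ≡ -[1+ 0 ] ℤ.* (h ℤ.* (z ℤ.- y))
      flip₂ = solve-∀
      signs : ∀ a b → -[1+ 0 ] ℤ.* a ℤ.* (-[1+ 0 ] ℤ.* b) ≡ b ℤ.* a
      signs = solve-∀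

  Π-sgn-act : ∀ {c} → c ≉0 → Π.sum (λ x → sgn (toℕ (act c x)) (toℕ x)) ≡ χ (c ℤ.* c ℤ.- + 1)
  Π-sgn-act {c} c≉0 = begin
    Π.sum (λ x → sgn (toℕ (act c x)) (toℕ x))
      ≡⟨ Π.sum-cong-≗ (λ x → trans (sgn-cls (*≉0 c≉0 (ι≉0 x)) x)
           (cong₂ (λ a b → ε a ℤ.* ε b) (collect₁ half c (ι x)) (collect₂ half c (ι x)))) ⟩
    Π.sum (λ x → ε (half ℤ.* (c ℤ.- + 1) ℤ.* ι x) ℤ.* ε (half ℤ.* (c ℤ.+ + 1) ℤ.* ι x))
      ≡⟨ Π.∑-distrib-+ (λ x → ε (half ℤ.* (c ℤ.- + 1) ℤ.* ι x)) _ ⟩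
    χ (half ℤ.* (c ℤ.- + 1)) ℤ.* χ (half ℤ.* (c ℤ.+ + 1))
      ≡⟨ χ-* (half ℤ.* (c ℤ.- + 1)) (half ℤ.* (c ℤ.+ + 1)) ⟨
    χ (half ℤ.* (c ℤ.- + 1) ℤ.* (half ℤ.* (c ℤ.+ + 1)))
      ≡⟨ cong χ (factor half c) ⟩
    χ (half ℤ.* half ℤ.* (c ℤ.* c ℤ.- + 1))
      ≡⟨ χ-square-* {half} (c ℤ.* c ℤ.- + 1) half≉0 ⟩
    χ (c ℤ.* c ℤ.- + 1) ∎
    where
    open ≡-Reasoning
    collect₁ : ∀ h c x → h ℤ.* (c ℤ.* x ℤ.- x) ≡ h ℤ.* (c ℤ.- + 1) ℤ.* x
    collect₁ = solve-∀
    collect₂ : ∀ h c x → h ℤ.* (c ℤ.* x ℤ.+ x) ≡ h ℤ.* (c ℤ.+ + 1) ℤ.* x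
    collect₂ = solve-∀
    factor : ∀ h c → h ℤ.* (c ℤ.- + 1) ℤ.* (h ℤ.* (c ℤ.+ + 1)) ≡ h ℤ.* h ℤ.* (c ℤ.* c ℤ.- + 1)
    factor = solve-∀

  -- Fixed classes, squares and inverses

  act-≡ : ∀ {c e} x → IsSign e → c ≈ e → act c x ≡ x
  act-≡ {c} x s h = proj₂ (ε-cls-unique s (*-congʳ (ι x) h))

  act-fixed : ∀ {c} x → c ≉0 → act c x ≡ x → ∃ λ e → IsSign e × c ≈ e
  act-fixed {c} x c≉0 h =
    let e , s , cx≈ex = cls-≡⇒≈ {c ℤ.* ι x} {ι x} (*≉0 c≉0 (ι≉0 x)) (ι≉0 x) (trans h (sym (cls-ι x)))
    in e , s , *-cancelˡ (ι x) c e (ι≉0 x)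
         (≈-trans (≡⇒≈ (ℤ.*-comm (ι x) c)) (≈-trans cx≈ex (≡⇒≈ (ℤ.*-comm e (ι x)))))

  square-cls : ∀ {z} → z ≉0 → ι (cls z) ℤ.* ι (cls z) ≈ z ℤ.* z
  square-cls {z} z≉0 = begin
    ι (cls z) ℤ.* ι (cls z)              ≈⟨ *-cong ι-cls ι-cls ⟩
    ε z ℤ.* z ℤ.* (ε z ℤ.* z)            ≡⟨ regroup (ε z) z ⟩
    ε z ℤ.* ε z ℤ.* (z ℤ.* z)            ≡⟨ cong (ℤ._* (z ℤ.* z)) (sign²≡1 {ε z} (ε-sign z≉0)) ⟩
    + 1 ℤ.* (z ℤ.* z)                    ≡⟨ ℤ.*-identityˡ (z ℤ.* z) ⟩
    z ℤ.* z                              ∎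
    where
    open ≈-Reasoning
    ι-cls : ι (cls z) ≈ ε z ℤ.* z
    ι-cls = sign*-inj {ε z} {ι (cls z)} {z} (ε-sign z≉0) (≈-sym (ε-cls z≉0))
    regroup : ∀ e z → e ℤ.* z ℤ.* (e ℤ.* z) ≡ e ℤ.* e ℤ.* (z ℤ.* z)
    regroup = solve-∀

  cls-inv : Fin n → Fin n
  cls-inv c = cls (inv (ι c))

  act-cls-inv : ∀ c x → act (ι (cls-inv c)) (act (ι c) x) ≡ x
  act-cls-inv c x = begin
    act (ι (cls-inv c)) (act (ι c) x)    ≡⟨ act-cls (ι≉0 (cls-inv c)) (*≉0 (ι≉0 c) (ι≉0 x)) ⟩
    cls (ι (cls-inv c) ℤ.* (ι c ℤ.* ι x))
      ≡⟨ cls-sign-* {ε b} {ι x} {ι (cls-inv c) ℤ.* (ι c ℤ.* ι x)} (ι≉0 x) (ε-sign b≉0) cancel ⟩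
    cls (ι x)                            ≡⟨ cls-ι x ⟩
    x                                    ∎
    where
    open ≡-Reasoning
    b = inv (ι c)
    b≉0 : b ≉0
    b≉0 = inv≉0 (ι≉0 c)
    regroup : ∀ e b c x → e ℤ.* b ℤ.* (c ℤ.* x) ≡ e ℤ.* (b ℤ.* c) ℤ.* x
    regroup = solve-∀
    cancel : ι (cls-inv c) ℤ.* (ι c ℤ.* ι x) ≈ ε b ℤ.* ι x
    cancel = ≈-trans (*-congʳ (ι c ℤ.* ι x) (sign*-inj {ε b} {ι (cls-inv c)} {b} (ε-sign b≉0) (≈-sym (ε-cls b≉0))))
      (≈-trans (≡⇒≈ (regroup (ε b) b (ι c) (ι x)))
      (≈-trans (*-congʳ (ι x) (*-congˡ (ε b) (inv-* (ι≉0 c))))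
               (≡⇒≈ (cong (ℤ._* ι x) (ℤ.*-identityʳ (ε b))))))

  act-one : ∀ c → act (ι c) one ≡ c
  act-one c = trans (cong cls (trans (cong (ι c ℤ.*_) ι-one) (ℤ.*-identityʳ (ι c)))) (cls-ι c)

  act-comm : ∀ c x → act (ι c) x ≡ act (ι x) c
  act-comm c x = cong cls (ℤ.*-comm (ι c) (ι x))

  cls-inv-involutive : ∀ c → cls-inv (cls-inv c) ≡ c
  cls-inv-involutive c = act-injective (ι≉0 (cls-inv c)) (begin
    act (ι d) (cls-inv d)                   ≡⟨ act-comm d (cls-inv d) ⟩
    act (ι (cls-inv d)) d                   ≡⟨ cong (act (ι (cls-inv d))) (act-one d) ⟨
    act (ι (cls-inv d)) (act (ι d) one)     ≡⟨ act-cls-inv d one ⟩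
    one                                     ≡⟨ act-cls-inv c one ⟨
    act (ι d) (act (ι c) one)               ≡⟨ cong (act (ι d)) (act-one c) ⟩
    act (ι d) c                             ∎)
    where
    open ≡-Reasoning
    d = cls-inv c

  cls-inv-fixed : ∀ c → cls-inv c ≡ c → ∃ λ e → IsSign e × ι c ℤ.* ι c ≈ e
  cls-inv-fixed c h =
    let e , s , q = cls-≡⇒≈ {ι c ℤ.* ι c} {+ 1} (*≉0 (ι≉0 c) (ι≉0 c)) 1≉0 c²
    in e , s , ≈-trans q (≡⇒≈ (ℤ.*-identityʳ e))
    where
    open ≡-Reasoning
    c² : cls (ι c ℤ.* ι c) ≡ cls (+ 1)
    c² = begin
      act (ι c) c                        ≡⟨ cong₂ (λ d x → act (ι d) x) (sym h) (sym (act-one c)) ⟩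
      act (ι (cls-inv c)) (act (ι c) one) ≡⟨ act-cls-inv c one ⟩
      one                                ≡⟨ cls-ι one ⟨
      cls (ι one)                        ≡⟨ cong cls ι-one ⟩
      cls (+ 1)                          ∎

  -- Grouping the inversions by ratio

  module Inversions (m : ℤ) (m≉0 : m ≉0) where

    τ : Fin n → Fin n
    τ x = cls (m ℤ.* (ι x ℤ.* ι x))

    mx²≉0 : ∀ x → m ℤ.* (ι x ℤ.* ι x) ≉0
    mx²≉0 x = *≉0 m≉0 (*≉0 (ι≉0 x) (ι≉0 x))

    τ-act : ∀ {c} x → c ≉0 → τ (act c x) ≡ act (c ℤ.* c) (τ x)
    τ-act {c} x c≉0 = sym (begin
      act (c ℤ.* c) (τ x)                            ≡⟨ act-cls (*≉0 c≉0 c≉0) (mx²≉0 x) ⟩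
      cls (c ℤ.* c ℤ.* (m ℤ.* (ι x ℤ.* ι x)))        ≡⟨ cls-cong (mx²≉0 (act c x)) squares ⟩
      cls (m ℤ.* (ι (act c x) ℤ.* ι (act c x)))      ∎)
      where
      open ≡-Reasoning
      regroup : ∀ c m x → c ℤ.* c ℤ.* (m ℤ.* (x ℤ.* x)) ≡ m ℤ.* (c ℤ.* x ℤ.* (c ℤ.* x))
      regroup = solve-∀
      squares : c ℤ.* c ℤ.* (m ℤ.* (ι x ℤ.* ι x)) ≈ m ℤ.* (ι (act c x) ℤ.* ι (act c x))
      squares = ≈-trans (≡⇒≈ (regroup c m (ι x))) (*-congˡ m (≈-sym (square-cls (*≉0 c≉0 (ι≉0 x)))))

    -- w x y is -1 exactly when τ inverts the pair {x , y}.
    w : Fin n → Fin n → ℤ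
    w x y = sgn (toℕ x) (toℕ y) ℤ.* sgn (toℕ (τ x)) (toℕ (τ y))

    w-sym : ∀ x y → w x y ≡ w y x
    w-sym x y = trans (cong₂ ℤ._*_ (sgn-antisym (toℕ x) (toℕ y)) (sgn-antisym (toℕ (τ x)) (toℕ (τ y))))
      (signs (sgn (toℕ y) (toℕ x)) (sgn (toℕ (τ y)) (toℕ (τ x))))
      where
      signs : ∀ a b → ℤ.- a ℤ.* (ℤ.- b) ≡ a ℤ.* b
      signs = solve-∀

    -- `N c` counts the x for which {x, c x} is inverted. `W c` is (-1)^N(c), except that it
    -- vanishes for c² = ±1, and `V c` is the factor of `W c` that comes from `τ`.
    V W N : Fin n → ℤ
    V c = Π.sum (λ x → sgn (toℕ (τ (act (ι c) x))) (toℕ (τ x)))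
    W c = Π.sum (λ x → w (act (ι c) x) x)
    N c = Σ.sum (λ x → neg (w (act (ι c) x) x))

    W≡ : ∀ c → W c ≡ χ (ι c ℤ.* ι c ℤ.- + 1) ℤ.* V c
    W≡ c = trans (Π.∑-distrib-+ (λ x → sgn (toℕ (act (ι c) x)) (toℕ x)) _)
      (cong (ℤ._* V c) (Π-sgn-act (ι≉0 c)))

    -- Multiplication by c becomes multiplication by c² under `τ`, and ±1 acts trivially on classes.
    τ-act-degenerate : ∀ {e} c x → IsSign e → ι c ℤ.* ι c ≈ e → τ (act (ι c) x) ≡ τ x
    τ-act-degenerate c x s h = trans (τ-act x (ι≉0 c)) (act-≡ (τ x) s h)

    V-degenerate : ∀ {e} c → IsSign e → ι c ℤ.* ι c ≈ e → V c ≡ + 0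
    V-degenerate c s h = Π-zero one (sgn-≡ (cong toℕ (τ-act-degenerate c one s h)))

    W-degenerate : ∀ {e} c → IsSign e → ι c ℤ.* ι c ≈ e → W c ≡ + 0
    W-degenerate c s h = trans (W≡ c) (trans (cong (χ (ι c ℤ.* ι c ℤ.- + 1) ℤ.*_) (V-degenerate c s h))
      (ℤ.*-zeroʳ (χ (ι c ℤ.* ι c ℤ.- + 1))))

    N-degenerate : ∀ {e} c → IsSign e → ι c ℤ.* ι c ≈ e → N c ≡ + 0
    N-degenerate c s h = Σ.sum-neutral (λ x → cong neg (trans
      (cong (sgn (toℕ (act (ι c) x)) (toℕ x) ℤ.*_) (sgn-≡ (cong toℕ (τ-act-degenerate c x s h))))
      (ℤ.*-zeroʳ (sgn (toℕ (act (ι c) x)) (toℕ x)))))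

    degenerate? : ∀ c → Dec (∃ λ e → IsSign e × ι c ℤ.* ι c ≈ e)
    degenerate? c with (ι c ℤ.* ι c ℤ.- + 1) ≈0? | (ι c ℤ.* ι c ℤ.- -[1+ 0 ]) ≈0?
    ... | yes h | _ = yes (+ 1 , inj₁ refl , sub≈0⇒≈ h)
    ... | no _ | yes h = yes (-[1+ 0 ] , inj₂ refl , sub≈0⇒≈ h)
    ... | no h₁ | no h₂ = no λ where
      (_ , inj₁ refl , h) → h₁ (≈⇒sub≈0 h)
      (_ , inj₂ refl , h) → h₂ (≈⇒sub≈0 h)

    V-factor-sign : ∀ c x → ¬ (∃ λ e → IsSign e × ι c ℤ.* ι c ≈ e) → IsSign (sgn (toℕ (τ (act (ι c) x))) (toℕ (τ x)))
    V-factor-sign c x nd = sgn-sign λ h → nd (act-fixed {ι c ℤ.* ι c} (τ x) (*≉0 (ι≉0 c) (ι≉0 c))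
      (trans (sym (τ-act x (ι≉0 c))) (Fin.toℕ-injective h)))

    w-sign : ∀ c x → ¬ (∃ λ e → IsSign e × ι c ℤ.* ι c ≈ e) → IsSign (w (act (ι c) x) x)
    w-sign c x nd = isSign-* (sgn-sign (moved ∘ Fin.toℕ-injective)) (V-factor-sign c x nd)
      where
      moved : act (ι c) x ≢ x
      moved h =
        let e , s , q = act-fixed {ι c} x (ι≉0 c) h
        in nd (e ℤ.* e , isSign-* s s , *-cong q q)

    N-parity : ∀ c → + 2 ∣ℤ N c ℤ.- neg (W c)
    N-parity c with degenerate? c
    ... | yes (e , s , h) = divides (+ 0) (cong₂ (λ a b → a ℤ.- neg b) (N-degenerate c s h) (W-degenerate c s h))
    ... | no nd = neg-Π (λ x → w-sign c x nd)

    -- The pair {x, c x} of ratio c, seen from c x, has ratio 1 / c.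
    w-cls-inv : ∀ c x → w (act (ι (cls-inv c)) (act (ι c) x)) (act (ι c) x) ≡ w (act (ι c) x) x
    w-cls-inv c x = trans (cong (λ y → w y (act (ι c) x)) (act-cls-inv c x)) (w-sym x (act (ι c) x))

    N-cls-inv : ∀ c → N (cls-inv c) ≡ N c
    N-cls-inv c = trans (Σ.sum-reindex (act-injective (ι≉0 c)) (λ x → neg (w (act (ι (cls-inv c)) x) x)))
      (Σ.sum-cong-≗ (λ x → cong neg (w-cls-inv c x)))

    W-cls-inv : ∀ c → W (cls-inv c) ≡ W c
    W-cls-inv c = trans (Π.sum-reindex (act-injective (ι≉0 c)) (λ x → w (act (ι (cls-inv c)) x) x))
      (Π.sum-cong-≗ (λ x → w-cls-inv c x))

    -- For fixed y, substitute x = c y with c running through all classes.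
    ∑w≡∑N : Σ.sum (λ y → Σ.sum (λ x → neg (w x y))) ≡ Σ.sum N
    ∑w≡∑N = begin
      Σ.sum (λ y → Σ.sum (λ x → neg (w x y)))
        ≡⟨ Σ.sum-cong-≗ (λ y → Σ.sum-reindex (act-injective (ι≉0 y)) (λ x → neg (w x y))) ⟩
      Σ.sum (λ y → Σ.sum (λ c → neg (w (act (ι y) c) y)))
        ≡⟨ Σ.sum-cong-≗ (λ y → Σ.sum-cong-≗ (λ c → cong (λ x → neg (w x y)) (act-comm y c))) ⟩
      Σ.sum (λ y → Σ.sum (λ c → neg (w (act (ι c) y) y)))
        ≡⟨ Σ.∑-comm (λ y c → neg (w (act (ι c) y) y)) ⟩
      Σ.sum N ∎
      where open ≡-Reasoning

    -- The class of {c , c⁻¹} contributes 2 N(c) to the double count, and only the parity of N(c) matters.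
    4∣∑N : + 4 ∣ℤ Σ.sum N ℤ.- Σ.sum (neg ∘ W)
    4∣∑N = subst (+ 4 ∣ℤ_) (sum-sub N (neg ∘ W))
      (4∣-involution cls-inv (λ c → N c ℤ.- neg (W c)) cls-inv-involutive
        (λ c → cong₂ (λ a b → a ℤ.- neg b) (N-cls-inv c) (W-cls-inv c)) N-parity fixed)
      where
      fixed : ∀ c → cls-inv c ≡ c → N c ℤ.- neg (W c) ≡ + 0
      fixed c h =
        let e , s , q = cls-inv-fixed c h
        in cong₂ (λ a b → a ℤ.- neg b) (N-degenerate c s q) (W-degenerate c s q)

    T : ℕ → ℕ
    T i = tilde p (m ℤ.* + (suc i ℕ.* suc i))

    T≡ : ∀ x → T (toℕ x) ≡ suc (toℕ (τ x))
    T≡ x = tilde-cls (mx²≉0 x)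

    -- `neg (w x y)` carried over to natural numbers, in which `sPrime` counts. Values of `tilde`
    -- exceed those of `τ` by one, which does not affect `sgn`.
    v : ℕ → ℕ → ℤ
    v i j = neg (sgn i j ℤ.* sgn (T i) (T j))

    v≡ : ∀ x y → v (toℕ x) (toℕ y) ≡ neg (w x y)
    v≡ x y = cong (λ s → neg (sgn (toℕ x) (toℕ y) ℤ.* s))
      (trans (cong₂ sgn (T≡ x) (T≡ y)) (sgn-suc (toℕ (τ x)) (toℕ (τ y))))

    v-sym : ∀ i j → v i j ≡ v j i
    v-sym i j = cong neg (trans (cong₂ ℤ._*_ (sgn-antisym i j) (sgn-antisym (T i) (T j)))
      (signs (sgn j i) (sgn (T j) (T i))))
      where
      signs : ∀ a b → ℤ.- a ℤ.* (ℤ.- b) ≡ a ℤ.* b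
      signs = solve-∀

    v-diag : ∀ i → v i i ≡ + 0
    v-diag i = cong (λ s → neg (s ℤ.* sgn (T i) (T i))) (sgn-≡ {i} refl)

    v-spec : ∀ i j → i < j → (T j < T i → v i j ≡ + 1) × (¬ (T j < T i) → v i j ≡ + 0)
    v-spec i j i<j = (λ lt → cong₂ (λ a b → neg (a ℤ.* b)) (sgn-< i<j) (sgn-> lt)) , not-inverted
      where
      not-inverted : ¬ (T j < T i) → v i j ≡ + 0
      not-inverted ¬lt = Sum.[ cong₂ (λ a b → neg (a ℤ.* b)) (sgn-< i<j) , cong₂ (λ a b → neg (a ℤ.* b)) (sgn-< i<j) ]
        (sgn-≯ ¬lt)

    inversions : ℕ
    inversions = length (filter
      (λ ij → tilde p (m ℤ.* + (proj₂ ij ℕ.* proj₂ ij)) ℕ.<? tilde p (m ℤ.* + (proj₁ ij ℕ.* proj₁ ij)))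
      (pairsBelow n))

    -- The sum over all ordered pairs sees each inversion twice, so a congruence modulo 4 carries
    -- the parity of the count.
    inversions-mod-4 : + 4 ∣ℤ (+ inversions ℤ.+ + inversions) ℤ.- Σ.sum (neg ∘ W)
    inversions-mod-4 = subst (λ s → + 4 ∣ℤ s ℤ.- Σ.sum (neg ∘ W)) (sym (begin
      + inversions ℤ.+ + inversions
        ≡⟨ length-filter-pairsBelow _ v v-sym v-diag v-spec n ⟩
      Σ.sum {n} (λ y → Σ.sum {n} (λ x → v (toℕ x) (toℕ y)))
        ≡⟨ Σ.sum-cong-≗ {n} (λ y → Σ.sum-cong-≗ {n} (λ x → v≡ x y)) ⟩
      Σ.sum (λ y → Σ.sum (λ x → neg (w x y)))
        ≡⟨ ∑w≡∑N ⟩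
      Σ.sum N ∎)) 4∣∑N
      where open ≡-Reasoning

  -- Jacobsthal sums

  Respects≈ : (ℤ → ℤ) → Set
  Respects≈ g = ∀ {a b} → a ≈ b → g a ≡ g b

  residue : Fin (suc (n ℕ.+ n)) → ℤ
  residue u = + toℕ u

  ∑F : (ℤ → ℤ) → ℤ
  ∑F g = Σ.sum (g ∘ residue)

  residue<p : ∀ u → toℕ u < p
  residue<p u = subst (toℕ u <_) (sym p≡1+2n) (Fin.toℕ<n u)

  residue-injective : ∀ {u v} → residue u ≈ residue v → u ≡ v
  residue-injective {u} {v} h = Fin.toℕ-injective (small-≈ (residue<p u) (residue<p v) h)

  reduce : ℤ → Fin (suc (n ℕ.+ n))
  reduce z = fromℕ< (subst (z %ℕ p <_) p≡1+2n (n%ℕd<d z p))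

  residue-reduce : ∀ z → residue (reduce z) ≈ z
  residue-reduce z = ≈-trans (≡⇒≈ (cong +_ (Fin.toℕ-fromℕ< (subst (z %ℕ p <_) p≡1+2n (n%ℕd<d z p))))) (≈-sym (≈-%ℕ z))

  ∑F-reindex : ∀ g φ → Respects≈ g → (∀ a b → φ a ≈ φ b → a ≈ b) → ∑F g ≡ ∑F (g ∘ φ)
  ∑F-reindex g φ resp inj = trans (Σ.sum-reindex f-inj (g ∘ residue))
    (Σ.sum-cong-≗ (λ u → resp (residue-reduce (φ (residue u)))))
    where
    f : Fin (suc (n ℕ.+ n)) → Fin (suc (n ℕ.+ n))
    f u = reduce (φ (residue u))
    f-inj : Injective _≡_ _≡_ f
    f-inj {u} {v} h = residue-injective (inj (residue u) (residue v)
      (≈-trans (≈-sym (residue-reduce (φ (residue u)))) (≈-trans (≡⇒≈ (cong residue h)) (residue-reduce (φ (residue v))))))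

  -- The residues 2n, ..., n + 1, the upper half read backwards by `opposite`, are -1, ..., -n.
  ∑F-split : ∀ g → Respects≈ g →
             ∑F g ≡ g (+ 0) ℤ.+ (Σ.sum (λ x → g (ι x)) ℤ.+ Σ.sum (λ x → g (ℤ.- ι x)))
  ∑F-split g resp = cong (ℤ._+_ (g (+ 0))) (begin
    Σ.sum {n ℕ.+ n} (λ u → g (+ suc (toℕ u)))
      ≡⟨ Σ.sum-toℕ-+ n n (λ i → g (+ suc i)) ⟩
    Σ.sum (λ x → g (ι x)) ℤ.+ Σ.sum (λ (x : Fin n) → g (+ suc (n ℕ.+ toℕ x)))
      ≡⟨ cong (ℤ._+_ (Σ.sum (λ x → g (ι x)))) (Σ.sum-reindex opposite-inj (λ (x : Fin n) → g (+ suc (n ℕ.+ toℕ x)))) ⟩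
    Σ.sum (λ x → g (ι x)) ℤ.+ Σ.sum (λ (x : Fin n) → g (+ suc (n ℕ.+ toℕ (opposite x))))
      ≡⟨ cong (ℤ._+_ (Σ.sum (λ x → g (ι x)))) (Σ.sum-cong-≗ (λ x → resp (mirror x))) ⟩
    Σ.sum (λ x → g (ι x)) ℤ.+ Σ.sum (λ x → g (ℤ.- ι x)) ∎)
    where
    open ≡-Reasoning
    opposite-inj : Injective _≡_ _≡_ (opposite {n})
    opposite-inj {x} {y} h = trans (sym (Fin.opposite-involutive x)) (trans (cong opposite h) (Fin.opposite-involutive y))
    add-back : ∀ x → suc (n ℕ.+ toℕ (opposite x)) ℕ.+ suc (toℕ x) ≡ p
    add-back x = trans (ℕ.+-assoc (suc n) (toℕ (opposite x)) (suc (toℕ x)))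
      (trans (cong (suc n ℕ.+_) (trans (cong (ℕ._+ suc (toℕ x)) (Fin.opposite-prop x)) (ℕ.m∸n+n≡m (Fin.toℕ<n x)))) (sym p≡1+2n))
    move : ∀ a b → a ℤ.- (ℤ.- b) ≡ a ℤ.+ b
    move = solve-∀
    mirror : ∀ x → + suc (n ℕ.+ toℕ (opposite x)) ≈ ℤ.- ι x
    mirror x = sub≈0⇒≈ (≈-trans (≡⇒≈ (trans (move (+ suc (n ℕ.+ toℕ (opposite x))) (ι x)) (cong +_ (add-back x)))) p≈0)

  -- Multiplication by `a` permutes the residues and changes the sign of every term, so the sum
  -- equals its own negative.
  ∑F-χ : ∀ {a} → χ a ≡ -[1+ 0 ] → ∑F χ ≡ + 0
  ∑F-χ {a} χa≡-1 = double-injective (begin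
    ∑F χ ℤ.+ ∑F χ                   ≡⟨ cong (ℤ._+_ (∑F χ)) (∑F-reindex χ (a ℤ.*_) χ-cong (λ b c → *-cancelˡ a b c a≉0)) ⟩
    ∑F χ ℤ.+ ∑F (λ b → χ (a ℤ.* b)) ≡⟨ cong (ℤ._+_ (∑F χ)) (Σ.sum-cong-≗ (λ u → flip (residue u))) ⟩
    ∑F χ ℤ.+ ∑F (λ b → ℤ.- χ b)     ≡⟨ cong (ℤ._+_ (∑F χ)) (sum-neg (χ ∘ residue)) ⟩
    ∑F χ ℤ.- ∑F χ                   ≡⟨ ℤ.+-inverseʳ (∑F χ) ⟩
    + 0                             ∎)
    where
    open ≡-Reasoning
    a≉0 : a ≉0
    a≉0 h = contradiction (trans (sym χa≡-1) (χ≈0 h)) λ ()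
    flip : ∀ b → χ (a ℤ.* b) ≡ ℤ.- χ b
    flip b = trans (χ-* a b) (trans (cong (ℤ._* χ b) χa≡-1) (ℤ.-1*i≡-i (χ b)))

  2≉0 : + 2 ≉0
  2≉0 h = half≉0 (≈-trans (≈-sym (half-* half)) (*≈0ʳ half (≈-trans (≡⇒≈ (double half)) (*≈0ˡ half h))))
    where
    double : ∀ a → a ℤ.+ a ≡ + 2 ℤ.* a
    double = solve-∀

  1≉-1 : ¬ (+ 1 ≈ -[1+ 0 ])
  1≉-1 h = 2≉0 (≈⇒sub≈0 h)

  inv-cong⁻¹ : ∀ a b → inv a ≈ inv b → a ≈ b
  inv-cong⁻¹ a b h with a ≈0? | b ≈0?
  ... | yes a≈0 | yes b≈0 = ≈-trans a≈0 (≈-sym b≈0)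
  ... | yes a≈0 | no b≉0 = contradiction (≈-trans (≈-sym h) (inv≈0 a≈0)) (inv≉0 b≉0)
  ... | no a≉0 | yes b≈0 = contradiction (≈-trans h (inv≈0 b≈0)) (inv≉0 a≉0)
  ... | no a≉0 | no b≉0 = *-cancelˡ (inv a) a b (inv≉0 a≉0)
    (≈-trans (inv-* a≉0) (≈-trans (≈-sym (inv-* b≉0)) (*-congʳ b (≈-sym h))))

  -- For c ≠ -1, c² - 1 is (c - 1)/(c + 1) times a square, and (c - 1)/(c + 1) = 1 - 2/(c + 1)
  -- runs through all residues except 1.
  ∑F-χ-square-1 : ∀ {a} → χ a ≡ -[1+ 0 ] → ∑F (λ c → χ (c ℤ.* c ℤ.- + 1)) ≡ -[1+ 0 ]
  ∑F-χ-square-1 {a} χa≡-1 = begin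
    ∑F (λ c → χ (c ℤ.* c ℤ.- + 1))
      ≡⟨ sum-except (λ u → χ (residue u ℤ.* residue u ℤ.- + 1)) (χ ∘ φ ∘ residue) u₀ at-u₀ off-u₀ ⟩
    ∑F (χ ∘ φ) ℤ.- χ (φ (residue u₀))
      ≡⟨ cong₂ ℤ._-_ (trans (sym (∑F-reindex χ φ χ-cong φ-inj)) (∑F-χ {a} χa≡-1))
           (trans (χ-cong φu₀≈1) χ-1) ⟩
    + 0 ℤ.- + 1
      ≡⟨⟩
    -[1+ 0 ] ∎
    where
    open ≡-Reasoning
    -- Since `inv` is 0 at 0, φ(-1) = 1. This is the one value that (c - 1) / (c + 1) omits, so φ
    -- permutes all residues, and the surplus term χ(1) = 1 is subtracted.
    φ : ℤ → ℤ
    φ c = + 1 ℤ.- + 2 ℤ.* inv (c ℤ.+ + 1)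
    undo : ∀ i → + 1 ℤ.- (+ 1 ℤ.- + 2 ℤ.* i) ≡ + 2 ℤ.* i
    undo = solve-∀
    φ-inj : ∀ b c → φ b ≈ φ c → b ≈ c
    φ-inj b c h = ≈-trans (≡⇒≈ (shift b)) (≈-trans (+-cong (inv-cong⁻¹ (b ℤ.+ + 1) (c ℤ.+ + 1)
        (*-cancelˡ (+ 2) (inv (b ℤ.+ + 1)) (inv (c ℤ.+ + 1)) 2≉0
          (≈-trans (≡⇒≈ (sym (undo (inv (b ℤ.+ + 1))))) (≈-trans (+-cong (≈-refl {+ 1}) (neg-cong h)) (≡⇒≈ (undo (inv (c ℤ.+ + 1))))))))
        (≈-refl { -[1+ 0 ] })) (≡⇒≈ (sym (shift c))))
      where
      shift : ∀ b → b ≡ b ℤ.+ + 1 ℤ.+ -[1+ 0 ]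
      shift = solve-∀
    u₀ = reduce -[1+ 0 ]
    u₀+1≈0 : residue u₀ ℤ.+ + 1 ≈ + 0
    u₀+1≈0 = +-cong (residue-reduce -[1+ 0 ]) (≈-refl {+ 1})
    φu₀≈1 : φ (residue u₀) ≈ + 1
    φu₀≈1 = +-cong (≈-refl {+ 1}) (neg-cong (*≈0ʳ (+ 2) (inv≈0 u₀+1≈0)))
    factor : ∀ c → c ℤ.* c ℤ.- + 1 ≡ (c ℤ.- + 1) ℤ.* (c ℤ.+ + 1)
    factor = solve-∀
    at-u₀ : χ (residue u₀ ℤ.* residue u₀ ℤ.- + 1) ≡ + 0
    at-u₀ = χ≈0 (≈-trans (≡⇒≈ (factor (residue u₀))) (*≈0ʳ (residue u₀ ℤ.- + 1) u₀+1≈0))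
    expand : ∀ c i → (c ℤ.+ + 1) ℤ.* (c ℤ.+ + 1) ℤ.* (+ 1 ℤ.- + 2 ℤ.* i) ≡
                     (c ℤ.+ + 1) ℤ.* (c ℤ.+ + 1) ℤ.- (+ 2 ℤ.* (c ℤ.+ + 1)) ℤ.* (i ℤ.* (c ℤ.+ + 1))
    expand = solve-∀
    collect : ∀ c → (c ℤ.+ + 1) ℤ.* (c ℤ.+ + 1) ℤ.- (+ 2 ℤ.* (c ℤ.+ + 1)) ℤ.* + 1 ≡ c ℤ.* c ℤ.- + 1
    collect = solve-∀
    clear : ∀ c → c ℤ.+ + 1 ≉0 → (c ℤ.+ + 1) ℤ.* (c ℤ.+ + 1) ℤ.* φ c ≈ c ℤ.* c ℤ.- + 1
    clear c h = ≈-trans (≡⇒≈ (expand c (inv (c ℤ.+ + 1)))) (≈-trans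
      (+-cong (≈-refl {(c ℤ.+ + 1) ℤ.* (c ℤ.+ + 1)}) (neg-cong (*-congˡ (+ 2 ℤ.* (c ℤ.+ + 1)) (inv-* h))))
      (≡⇒≈ (collect c)))
    off-u₀ : ∀ u → u ≢ u₀ → χ (residue u ℤ.* residue u ℤ.- + 1) ≡ χ (φ (residue u))
    off-u₀ u u≢u₀ = trans (χ-cong (≈-sym (clear c c+1≉0))) (χ-square-* {c ℤ.+ + 1} (φ c) c+1≉0)
      where
      c = residue u
      c+1≉0 : c ℤ.+ + 1 ≉0
      c+1≉0 h = u≢u₀ (residue-injective (≈-trans (sub≈0⇒≈ {c} { -[1+ 0 ]} h) (≈-sym (residue-reduce -[1+ 0 ]))))

  -- χ(-1) = (-1)^n, as each of the n factors ε(-x) is -1.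
  χ-neg : ∀ a → χ (ℤ.- a) ≡ alt n ℤ.* χ a
  χ-neg a = trans (cong χ (sym (ℤ.-1*i≡-i a))) (trans (χ-* -[1+ 0 ] a) (cong (ℤ._* χ a) χ-1≡alt))
    where
    Π-neg-ones : ∀ k → Π.sum {k} (λ _ → -[1+ 0 ]) ≡ alt k
    Π-neg-ones zero = refl
    Π-neg-ones (suc k) = trans (cong (-[1+ 0 ] ℤ.*_) (Π-neg-ones k)) (ℤ.-1*i≡-i (alt k))
    χ-1≡alt : χ -[1+ 0 ] ≡ alt n
    χ-1≡alt = trans (Π.sum-cong-≗ (λ x → proj₁ (ε-cls-unique { -[1+ 0 ] ℤ.* ι x} (inj₂ refl) ≈-refl))) (Π-neg-ones n)

  -- The summand is even in c, so the sum over all residues is its value χ(-1) = (-1)^n at 0 plus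
  -- twice the sum over 1, ..., n.
  sum-χ-square-1 : ∀ {a} → χ a ≡ -[1+ 0 ] →
    alt n ℤ.+ (Σ.sum (λ c → χ (ι c ℤ.* ι c ℤ.- + 1)) ℤ.+ Σ.sum (λ c → χ (ι c ℤ.* ι c ℤ.- + 1))) ≡ -[1+ 0 ]
  sum-χ-square-1 {a} χa≡-1 = trans (sym (trans
    (∑F-split (λ c → χ (c ℤ.* c ℤ.- + 1)) (λ h → χ-cong (+-cong (*-cong h h) (≈-refl { -[1+ 0 ] }))))
    (cong₂ ℤ._+_ at-0 (cong (ℤ._+_ S) (Σ.sum-cong-≗ (λ c → cong χ (even (ι c))))))))
    (∑F-χ-square-1 {a} χa≡-1)
    where
    S = Σ.sum (λ c → χ (ι c ℤ.* ι c ℤ.- + 1))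
    even : ∀ c → ℤ.- c ℤ.* (ℤ.- c) ℤ.- + 1 ≡ c ℤ.* c ℤ.- + 1
    even = solve-∀
    at-0 : χ -[1+ 0 ] ≡ alt n
    at-0 = trans (χ-neg (+ 1)) (trans (cong (alt n ℤ.*_) χ-1) (ℤ.*-identityʳ (alt n)))

  -- χ(2) equals χ(1/2) because their product is χ(1) = 1, and the signs of halves are known from
  -- `ε-half`.
  χ-2 : χ (+ 2) ≡ Π.sum {n} (λ x → alt (suc (toℕ x)))
  χ-2 = begin
    χ (+ 2)                           ≡⟨ ℤ.*-identityʳ (χ (+ 2)) ⟨
    χ (+ 2) ℤ.* + 1                   ≡⟨ cong (χ (+ 2) ℤ.*_) (sign²≡1 {χ half} (χ-sign half≉0)) ⟨
    χ (+ 2) ℤ.* (χ half ℤ.* χ half)   ≡⟨ ℤ.*-assoc (χ (+ 2)) (χ half) (χ half) ⟨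
    χ (+ 2) ℤ.* χ half ℤ.* χ half     ≡⟨ cong (ℤ._* χ half) (χ-* (+ 2) half) ⟨
    χ (+ 2 ℤ.* half) ℤ.* χ half       ≡⟨ cong (ℤ._* χ half) (trans (χ-cong (≈-trans (≡⇒≈ (double half)) half-double)) χ-1) ⟩
    + 1 ℤ.* χ half                    ≡⟨ ℤ.*-identityˡ (χ half) ⟩
    χ half                            ≡⟨ Π.sum-cong-≗ (λ x → ε-half (suc (toℕ x)) (s≤s z≤n) (ℕ.≤-trans (Fin.toℕ<n x) (ℕ.m≤m+n n n))) ⟩
    Π.sum {n} (λ x → alt (suc (toℕ x))) ∎
    where
    open ≡-Reasoning
    double : ∀ a → + 2 ℤ.* a ≡ a ℤ.+ a
    double = solve-∀

  -- Twice neg u is u² - u for u ∈ {0, ±1}.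
  sum-neg-double : ∀ {E : Fin n → ℤ} → (∀ c → E c ≡ + 0 ⊎ IsSign (E c)) →
    Σ.sum (neg ∘ E) ℤ.+ Σ.sum (neg ∘ E) ≡ Σ.sum (λ c → E c ℤ.* E c) ℤ.- Σ.sum E
  sum-neg-double {E} s = trans (sym (Σ.∑-distrib-+ (neg ∘ E) (neg ∘ E)))
    (trans (Σ.sum-cong-≗ (λ c → double (s c))) (sum-sub (λ c → E c ℤ.* E c) E))
    where
    double : ∀ {u} → u ≡ + 0 ⊎ IsSign u → neg u ℤ.+ neg u ≡ u ℤ.* u ℤ.- u
    double (inj₁ refl) = refl
    double (inj₂ (inj₁ refl)) = refl
    double (inj₂ (inj₂ refl)) = refl

  ι-square-1 : ∀ c → ι c ℤ.* ι c ≈ + 1 → c ≡ one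
  ι-square-1 c h =
    let e , s , q = square-≈ (ι c) (+ 1) h
    in proj₂ (signed-unique {+ 1} {e} {c} {one} (inj₁ refl) s
         (≈-trans (≡⇒≈ (ℤ.*-identityˡ (ι c))) (≈-trans q (≡⇒≈ (cong (e ℤ.*_) (sym ι-one))))))

  sq : Fin n → Fin n
  sq x = cls (ι x ℤ.* ι x)

  -- The case p ≡ 3 mod 4

  module OddCase (k : ℕ) (n≡1+2k : n ≡ suc (k ℕ.+ k)) where

    -- A square root of -1 would act on the n classes as an involution without fixed points.
    no-√-1 : ∀ a → ¬ (a ℤ.* a ≈ -[1+ 0 ])
    no-√-1 a h = odd≢even k A (begin
      + suc (k ℕ.+ k)          ≡⟨ cong +_ n≡1+2k ⟨
      + n                      ≡⟨ sum-ones n ⟨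
      Σ.sum {n} (λ _ → + 1)    ≡⟨ Σ.sum-involution (act a) (λ _ → + 1) invol (λ _ → refl) ⟩
      Σ.sum (Σ.fixedPart (act a) (λ _ → + 1)) ℤ.+ (A ℤ.+ A)
                               ≡⟨ cong (ℤ._+ (A ℤ.+ A)) (Σ.sum-neutral no-fixed) ⟩
      + 0 ℤ.+ (A ℤ.+ A)        ≡⟨ ℤ.+-identityˡ (A ℤ.+ A) ⟩
      A ℤ.+ A                  ∎)
      where
      open ≡-Reasoning
      A = Σ.sum (Σ.ascendingPart (act a) (λ _ → + 1))
      a≉0 : a ≉0
      a≉0 a≈0 = sign≉0 (inj₂ refl) (≈-trans (≈-sym h) (*≈0ˡ a a≈0))
      invol : ∀ x → act a (act a x) ≡ x
      invol x = trans (act-cls {a} {a ℤ.* ι x} a≉0 (*≉0 a≉0 (ι≉0 x)))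
        (proj₂ (ε-cls-unique {a ℤ.* (a ℤ.* ι x)} { -[1+ 0 ]} {x} (inj₂ refl)
          (≈-trans (≡⇒≈ (sym (ℤ.*-assoc a a (ι x)))) (*-congʳ (ι x) h))))
      moved : ∀ x → act a x ≢ x
      moved x fixed =
        let e , s , q = act-fixed {a} x a≉0 fixed
        in 1≉-1 (≈-trans (≡⇒≈ (sym (sign²≡1 {e} s))) (≈-trans (≈-sym (*-cong q q)) h))
      no-fixed : ∀ x → Σ.fixedPart (act a) (λ _ → + 1) x ≡ + 0
      no-fixed x with act a x Fin.≟ x
      ... | yes fixed = contradiction fixed (moved x)
      ... | no _ = refl

    -- The sign -1 would make x / y a square root of -1.
    ι²≈ : ∀ {e} x y → IsSign e → ι x ℤ.* ι x ≈ e ℤ.* (ι y ℤ.* ι y) → x ≡ y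
    ι²≈ x y (inj₁ refl) h =
      let e , s , q = square-≈ (ι x) (ι y) (≈-trans h (≡⇒≈ (ℤ.*-identityˡ (ι y ℤ.* ι y))))
      in proj₂ (signed-unique {+ 1} {e} {x} {y} (inj₁ refl) s (≈-trans (≡⇒≈ (ℤ.*-identityˡ (ι x))) q))
    ι²≈ x y (inj₂ refl) h = contradiction
      (begin
        ι x ℤ.* i ℤ.* (ι x ℤ.* i)                          ≡⟨ regroup (ι x) i ⟩
        ι x ℤ.* ι x ℤ.* (i ℤ.* i)                          ≈⟨ *-congʳ (i ℤ.* i) h ⟩
        -[1+ 0 ] ℤ.* (ι y ℤ.* ι y) ℤ.* (i ℤ.* i)           ≡⟨ collect (ι y) i ⟩
        -[1+ 0 ] ℤ.* (i ℤ.* ι y ℤ.* (i ℤ.* ι y))           ≈⟨ *-congˡ -[1+ 0 ] (*-cong (inv-* (ι≉0 y)) (inv-* (ι≉0 y))) ⟩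
        -[1+ 0 ]                                           ∎)
      (no-√-1 (ι x ℤ.* i))
      where
      open ≈-Reasoning
      i = inv (ι y)
      regroup : ∀ x i → x ℤ.* i ℤ.* (x ℤ.* i) ≡ x ℤ.* x ℤ.* (i ℤ.* i)
      regroup = solve-∀
      collect : ∀ y i → -[1+ 0 ] ℤ.* (y ℤ.* y) ℤ.* (i ℤ.* i) ≡ -[1+ 0 ] ℤ.* (i ℤ.* y ℤ.* (i ℤ.* y))
      collect = solve-∀

    sq-injective : Injective _≡_ _≡_ sq
    sq-injective {x} {y} h =
      let e , s , q = cls-≡⇒≈ {ι x ℤ.* ι x} {ι y ℤ.* ι y} (*≉0 (ι≉0 x) (ι≉0 x)) (*≉0 (ι≉0 y) (ι≉0 y)) h
      in ι²≈ x y s q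

    alt-n : alt n ≡ -[1+ 0 ]
    alt-n = trans (cong alt n≡1+2k) (cong ℤ.-_ (alt-double k))

    χ-neg-odd : ∀ a → χ (ℤ.- a) ≡ ℤ.- χ a
    χ-neg-odd a = trans (χ-neg a) (trans (cong (ℤ._* χ a) alt-n) (ℤ.-1*i≡-i (χ a)))

    χ-minus-one : χ -[1+ 0 ] ≡ -[1+ 0 ]
    χ-minus-one = trans (χ-neg-odd (+ 1)) (cong ℤ.-_ χ-1)

    E : Fin n → ℤ
    E c = χ (ι c ℤ.* ι c ℤ.+ + 1)

    D : Fin n → ℤ
    D c = χ (ι c ℤ.* ι c ℤ.- + 1)

    sum-D : Σ.sum D ≡ + 0
    sum-D = double-injective (begin
      S ℤ.+ S                              ≡⟨ shift (S ℤ.+ S) ⟩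
      -[1+ 0 ] ℤ.+ (S ℤ.+ S) ℤ.+ + 1       ≡⟨ cong (λ z → z ℤ.+ (S ℤ.+ S) ℤ.+ + 1) alt-n ⟨
      alt n ℤ.+ (S ℤ.+ S) ℤ.+ + 1          ≡⟨ cong (ℤ._+ + 1) (sum-χ-square-1 { -[1+ 0 ]} χ-minus-one) ⟩
      + 0                                  ∎)
      where
      open ≡-Reasoning
      S = Σ.sum D
      shift : ∀ s → s ≡ -[1+ 0 ] ℤ.+ s ℤ.+ + 1
      shift = solve-∀

    -- Every nonzero residue is ±c² for exactly one class c, so the sum of χ(u + 1) over all u
    -- splits into the sums of χ(c² + 1) and χ(1 - c²).
    sum-E : Σ.sum E ≡ -[1+ 0 ]
    sum-E = begin
      Σ.sum E
        ≡⟨ shift (Σ.sum E) ⟩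
      + 1 ℤ.+ (Σ.sum E ℤ.- + 0) ℤ.+ -[1+ 0 ]
        ≡⟨ cong (λ z → + 1 ℤ.+ (Σ.sum E ℤ.- z) ℤ.+ -[1+ 0 ]) sum-D ⟨
      + 1 ℤ.+ (Σ.sum E ℤ.- Σ.sum D) ℤ.+ -[1+ 0 ]
        ≡⟨ cong₂ (λ a b → a ℤ.+ b ℤ.+ -[1+ 0 ]) (sym χ-1) (sym (sum-sub E D)) ⟩
      χ (+ 1) ℤ.+ Σ.sum (λ c → E c ℤ.- D c) ℤ.+ -[1+ 0 ]
        ≡⟨ cong (λ z → χ (+ 1) ℤ.+ z ℤ.+ -[1+ 0 ]) (Σ.sum-cong-≗ at-sq) ⟨
      χ (+ 1) ℤ.+ Σ.sum (g ∘ sq) ℤ.+ -[1+ 0 ]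
        ≡⟨ cong (λ z → χ (+ 1) ℤ.+ z ℤ.+ -[1+ 0 ]) (Σ.sum-reindex sq-injective g) ⟨
      χ (+ 1) ℤ.+ Σ.sum g ℤ.+ -[1+ 0 ]
        ≡⟨ cong (λ z → χ (+ 1) ℤ.+ z ℤ.+ -[1+ 0 ]) (Σ.∑-distrib-+ (λ x → χ (ι x ℤ.+ + 1)) (λ x → χ (ℤ.- ι x ℤ.+ + 1))) ⟩
      χ (+ 1) ℤ.+ (Σ.sum (λ x → χ (ι x ℤ.+ + 1)) ℤ.+ Σ.sum (λ x → χ (ℤ.- ι x ℤ.+ + 1))) ℤ.+ -[1+ 0 ]
        ≡⟨ cong (ℤ._+ -[1+ 0 ]) (∑F-split (λ u → χ (u ℤ.+ + 1)) (λ h → χ-cong (+-cong h (≈-refl {+ 1})))) ⟨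
      ∑F (λ u → χ (u ℤ.+ + 1)) ℤ.+ -[1+ 0 ]
        ≡⟨ cong (ℤ._+ -[1+ 0 ]) (∑F-reindex χ (ℤ._+ + 1) χ-cong shift-inj) ⟨
      ∑F χ ℤ.+ -[1+ 0 ]
        ≡⟨ cong (ℤ._+ -[1+ 0 ]) (∑F-χ { -[1+ 0 ]} χ-minus-one) ⟩
      -[1+ 0 ] ∎
      where
      open ≡-Reasoning
      shift : ∀ s → s ≡ + 1 ℤ.+ (s ℤ.- + 0) ℤ.+ -[1+ 0 ]
      shift = solve-∀
      g : Fin n → ℤ
      g x = χ (ι x ℤ.+ + 1) ℤ.+ χ (ℤ.- ι x ℤ.+ + 1)
      cancel : ∀ a → a ≡ a ℤ.+ + 1 ℤ.+ -[1+ 0 ]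
      cancel = solve-∀
      shift-inj : ∀ a b → a ℤ.+ + 1 ≈ b ℤ.+ + 1 → a ≈ b
      shift-inj a b h = ≈-trans (≡⇒≈ (cancel a)) (≈-trans (+-cong h (≈-refl { -[1+ 0 ]})) (≡⇒≈ (sym (cancel b))))
      g-sign : ∀ {e} x z → IsSign e → z ≈ e ℤ.* ι x → g x ≡ χ (z ℤ.+ + 1) ℤ.+ χ (ℤ.- z ℤ.+ + 1)
      g-sign x z (inj₁ refl) h = sym (cong₂ ℤ._+_
        (χ-cong (+-cong z≈x (≈-refl {+ 1}))) (χ-cong (+-cong (neg-cong z≈x) (≈-refl {+ 1}))))
        where
        z≈x : z ≈ ι x
        z≈x = ≈-trans h (≡⇒≈ (ℤ.*-identityˡ (ι x)))
      g-sign x z (inj₂ refl) h = trans (ℤ.+-comm (χ (ι x ℤ.+ + 1)) (χ (ℤ.- ι x ℤ.+ + 1))) (sym (cong₂ ℤ._+_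
        (χ-cong (+-cong z≈-x (≈-refl {+ 1})))
        (χ-cong (+-cong (≈-trans (neg-cong z≈-x) (≡⇒≈ (ℤ.neg-involutive (ι x)))) (≈-refl {+ 1})))))
        where
        z≈-x : z ≈ ℤ.- ι x
        z≈-x = ≈-trans h (≡⇒≈ (ℤ.-1*i≡-i (ι x)))
      flip : ∀ z → ℤ.- z ℤ.+ + 1 ≡ ℤ.- (z ℤ.- + 1)
      flip = solve-∀
      at-sq : ∀ c → g (sq c) ≡ E c ℤ.- D c
      at-sq c = trans (g-sign {ε (ι c ℤ.* ι c)} (sq c) (ι c ℤ.* ι c) (ε-sign c²≉0) (ε-cls c²≉0))
        (cong (ℤ._+_ (E c)) (trans (cong χ (flip (ι c ℤ.* ι c))) (χ-neg-odd (ι c ℤ.* ι c ℤ.- + 1))))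
        where
        c²≉0 : ι c ℤ.* ι c ≉0
        c²≉0 = *≉0 (ι≉0 c) (ι≉0 c)

    E-sign : ∀ c → IsSign (E c)
    E-sign c = χ-sign λ h → no-√-1 (ι c) (sub≈0⇒≈ {ι c ℤ.* ι c} { -[1+ 0 ]} h)

    -- No `E c` vanishes, since -1 is not a square; n signs with sum -1 include (n + 1) / 2 = k + 1
    -- negative ones.
    sum-neg-E : Σ.sum (neg ∘ E) ≡ + suc k
    sum-neg-E = double-injective (begin
      Σ.sum (neg ∘ E) ℤ.+ Σ.sum (neg ∘ E)
        ≡⟨ sum-neg-double {E} (λ c → inj₂ (E-sign c)) ⟩
      Σ.sum (λ c → E c ℤ.* E c) ℤ.- Σ.sum E
        ≡⟨ cong₂ ℤ._-_ (trans (Σ.sum-cong-≗ (λ c → sign²≡1 {E c} (E-sign c))) (sum-ones n)) sum-E ⟩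
      + n ℤ.- -[1+ 0 ]
        ≡⟨ cong (λ j → + j ℤ.- -[1+ 0 ]) n≡1+2k ⟩
      + suc (k ℕ.+ k) ℤ.- -[1+ 0 ]
        ≡⟨ regroup (+ k) ⟩
      + suc k ℤ.+ + suc k ∎)
      where
      open ≡-Reasoning
      regroup : ∀ k → + 1 ℤ.+ (k ℤ.+ k) ℤ.- -[1+ 0 ] ≡ + 1 ℤ.+ k ℤ.+ (+ 1 ℤ.+ k)
      regroup = solve-∀

    module _ (m : ℤ) (m≉0 : m ≉0) where
      open Inversions m m≉0

      τ-injective : Injective _≡_ _≡_ τ
      τ-injective {x} {y} h = sq-injective (act-injective m≉0
        (trans (act-cls m≉0 (*≉0 (ι≉0 x) (ι≉0 x))) (trans h (sym (act-cls m≉0 (*≉0 (ι≉0 y) (ι≉0 y)))))))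

      -- Since `τ` is a permutation, τ x may be replaced by x, which leaves the sign product for
      -- ratio c².
      V≡ : ∀ c → V c ≡ χ (ι c ℤ.* ι c ℤ.* (ι c ℤ.* ι c) ℤ.- + 1)
      V≡ c = begin
        V c
          ≡⟨ Π.sum-cong-≗ (λ x → cong (λ y → sgn (toℕ y) (toℕ (τ x))) (τ-act x (ι≉0 c))) ⟩
        Π.sum (λ x → sgn (toℕ (act (ι c ℤ.* ι c) (τ x))) (toℕ (τ x)))
          ≡⟨ Π.sum-reindex τ-injective (λ x → sgn (toℕ (act (ι c ℤ.* ι c) x)) (toℕ x)) ⟨
        Π.sum (λ x → sgn (toℕ (act (ι c ℤ.* ι c) x)) (toℕ x))
          ≡⟨ Π-sgn-act {ι c ℤ.* ι c} (*≉0 (ι≉0 c) (ι≉0 c)) ⟩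
        χ (ι c ℤ.* ι c ℤ.* (ι c ℤ.* ι c) ℤ.- + 1) ∎
        where open ≡-Reasoning

      W-generic : ∀ c → c ≢ one → W c ≡ E c
      W-generic c c≢one = begin
        W c
          ≡⟨ trans (W≡ c) (cong (D c ℤ.*_) (V≡ c)) ⟩
        χ d ℤ.* χ (ι c ℤ.* ι c ℤ.* (ι c ℤ.* ι c) ℤ.- + 1)
          ≡⟨ χ-* d (ι c ℤ.* ι c ℤ.* (ι c ℤ.* ι c) ℤ.- + 1) ⟨
        χ (d ℤ.* (ι c ℤ.* ι c ℤ.* (ι c ℤ.* ι c) ℤ.- + 1))
          ≡⟨ cong χ (factor (ι c ℤ.* ι c)) ⟩
        χ (d ℤ.* d ℤ.* (ι c ℤ.* ι c ℤ.+ + 1))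
          ≡⟨ χ-square-* {d} (ι c ℤ.* ι c ℤ.+ + 1) (λ h → c≢one (ι-square-1 c (sub≈0⇒≈ h))) ⟩
        E c ∎
        where
        open ≡-Reasoning
        d = ι c ℤ.* ι c ℤ.- + 1
        factor : ∀ r → (r ℤ.- + 1) ℤ.* (r ℤ.* r ℤ.- + 1) ≡ (r ℤ.- + 1) ℤ.* (r ℤ.- + 1) ℤ.* (r ℤ.+ + 1)
        factor = solve-∀

      E-one : E one ≡ alt (suc k)
      E-one = trans (cong (λ z → χ (z ℤ.* z ℤ.+ + 1)) ι-one) (trans χ-2
        (trans (cong (λ j → Π.sum {j} (λ x → alt (suc (toℕ x)))) n≡1+2k) (Π-alt-odd k)))

      -- The exceptional ratio is 1: there `W` vanishes, while `E` has the value χ(2), which has to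
      -- be taken out of the count.
      sum-neg-W-odd : Σ.sum (neg ∘ W) ≡ + suc k ℤ.- neg (alt (suc k))
      sum-neg-W-odd = trans
        (sum-except (neg ∘ W) (neg ∘ E) one
          (cong neg (W-degenerate {+ 1} one (inj₁ refl) (≡⇒≈ (cong (λ z → z ℤ.* z) ι-one))))
          (λ c c≢one → cong neg (W-generic c c≢one)))
        (cong₂ (λ a b → a ℤ.- neg b) sum-neg-E E-one)

  -- The case p ≡ 1 mod 4

  -- The involution sending x to the class of a / x. The product of its signs `δ` is evaluated
  -- twice: as χ(a) times a factor independent of a, and as a product over the fixed classes, where
  -- x² = ±a. Comparing a = 1 with a nonsquare determines χ at the latter.
  module Division (a : ℤ) (a≉0 : a ≉0) where

    δ : Fin n → ℤ
    δ x = ε (a ℤ.* inv (ι x))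

    div : Fin n → Fin n
    div x = cls (a ℤ.* inv (ι x))

    quotient≉0 : ∀ x → a ℤ.* inv (ι x) ≉0
    quotient≉0 x = *≉0 a≉0 (inv≉0 (ι≉0 x))

    δ-sign : ∀ x → IsSign (δ x)
    δ-sign x = ε-sign (quotient≉0 x)

    ι-div : ∀ x → ι (div x) ≈ δ x ℤ.* (a ℤ.* inv (ι x))
    ι-div x = sign*-inj {δ x} {ι (div x)} {a ℤ.* inv (ι x)} (δ-sign x) (≈-sym (ε-cls (quotient≉0 x)))

    div-div : ∀ x → a ℤ.* inv (ι (div x)) ≈ δ x ℤ.* ι x
    div-div x = begin
      a ℤ.* inv (ι (div x))                              ≈⟨ *-congˡ a (inv-unique {ι (div x)} {δ x ℤ.* (inv a ℤ.* ι x)} inverse) ⟩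
      a ℤ.* (δ x ℤ.* (inv a ℤ.* ι x))                    ≡⟨ regroup a (δ x) (inv a) (ι x) ⟩
      inv a ℤ.* a ℤ.* (δ x ℤ.* ι x)                      ≈⟨ *-congʳ (δ x ℤ.* ι x) (inv-* a≉0) ⟩
      + 1 ℤ.* (δ x ℤ.* ι x)                              ≡⟨ ℤ.*-identityˡ (δ x ℤ.* ι x) ⟩
      δ x ℤ.* ι x                                        ∎
      where
      open ≈-Reasoning
      regroup : ∀ a d i x → a ℤ.* (d ℤ.* (i ℤ.* x)) ≡ i ℤ.* a ℤ.* (d ℤ.* x)
      regroup = solve-∀
      collect : ∀ d i x a j → d ℤ.* (i ℤ.* x) ℤ.* (d ℤ.* (a ℤ.* j)) ≡ d ℤ.* d ℤ.* (i ℤ.* a ℤ.* (j ℤ.* x))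
      collect = solve-∀
      inverse : δ x ℤ.* (inv a ℤ.* ι x) ℤ.* ι (div x) ≈ + 1
      inverse = begin
        δ x ℤ.* (inv a ℤ.* ι x) ℤ.* ι (div x)
          ≈⟨ *-congˡ (δ x ℤ.* (inv a ℤ.* ι x)) (ι-div x) ⟩
        δ x ℤ.* (inv a ℤ.* ι x) ℤ.* (δ x ℤ.* (a ℤ.* inv (ι x)))
          ≡⟨ collect (δ x) (inv a) (ι x) a (inv (ι x)) ⟩
        δ x ℤ.* δ x ℤ.* (inv a ℤ.* a ℤ.* (inv (ι x) ℤ.* ι x))
          ≈⟨ *-cong (≡⇒≈ (sign²≡1 {δ x} (δ-sign x))) (*-cong (inv-* a≉0) (inv-* (ι≉0 x))) ⟩
        + 1 ∎

    div-involutive : ∀ x → div (div x) ≡ x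
    div-involutive x = proj₂ (ε-cls-unique (δ-sign x) (div-div x))

    δ-div : ∀ x → δ (div x) ≡ δ x
    δ-div x = proj₁ (ε-cls-unique (δ-sign x) (div-div x))

    div-fixed : ∀ x → div x ≡ x → ι x ℤ.* ι x ≈ δ x ℤ.* a
    div-fixed x h = begin
      ι x ℤ.* ι x                              ≡⟨ cong (λ y → ι y ℤ.* ι x) h ⟨
      ι (div x) ℤ.* ι x                        ≈⟨ *-congʳ (ι x) (ι-div x) ⟩
      δ x ℤ.* (a ℤ.* inv (ι x)) ℤ.* ι x        ≡⟨ regroup (δ x) a (inv (ι x)) (ι x) ⟩
      δ x ℤ.* a ℤ.* (inv (ι x) ℤ.* ι x)        ≈⟨ *-congˡ (δ x ℤ.* a) (inv-* (ι≉0 x)) ⟩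
      δ x ℤ.* a ℤ.* + 1                        ≡⟨ ℤ.*-identityʳ (δ x ℤ.* a) ⟩
      δ x ℤ.* a                                ∎
      where
      open ≈-Reasoning
      regroup : ∀ d a i x → d ℤ.* (a ℤ.* i) ℤ.* x ≡ d ℤ.* a ℤ.* (i ℤ.* x)
      regroup = solve-∀

    Π-δ : Π.sum δ ≡ Π.sum (Π.fixedPart div δ)
    Π-δ = Π-involution div δ div-involutive δ-div δ-sign

    Π-δ-χ : Π.sum δ ≡ χ a ℤ.* Π.sum (λ x → ε (inv (ι x)))
    Π-δ-χ = χ-factor (λ x → inv≉0 (ι≉0 x)) cls-inv-injective a
      where
      cls-inv-injective : Injective _≡_ _≡_ cls-inv
      cls-inv-injective {x} {y} h =
        trans (sym (cls-inv-involutive x)) (trans (cong cls-inv h) (cls-inv-involutive y))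

  module EvenCase (k : ℕ) (n≡2k : n ≡ k ℕ.+ k) where

    cls-inv-one : cls-inv one ≡ one
    cls-inv-one = begin
      cls-inv one                       ≡⟨ act-one (cls-inv one) ⟨
      act (ι (cls-inv one)) one         ≡⟨ cong (act (ι (cls-inv one))) (act-one one) ⟨
      act (ι (cls-inv one)) (act (ι one) one) ≡⟨ act-cls-inv one one ⟩
      one                               ∎
      where open ≡-Reasoning

    -- Inversion fixes the class of 1, so on an even number of classes it has another fixed point.
    abstract
      other-fixed : ∃ λ c → c ≢ one × cls-inv c ≡ c
      other-fixed = decidable-stable (Fin.any? (λ c → ¬? (c Fin.≟ one) ×-dec (cls-inv c Fin.≟ c)))
        -- Were `one` the only fixed class, n = 1 + 2A would contradict n = 2k.
        λ none → odd≢even 0 (+ k ℤ.- A) (begin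
          + 1                       ≡⟨ shift (+ 1) (A ℤ.+ A) ⟩
          + 1 ℤ.+ (A ℤ.+ A) ℤ.- (A ℤ.+ A)
                                    ≡⟨ cong (λ z → z ℤ.+ (A ℤ.+ A) ℤ.- (A ℤ.+ A)) (only-one none) ⟨
          F ℤ.+ (A ℤ.+ A) ℤ.- (A ℤ.+ A)
                                    ≡⟨ cong (ℤ._- (A ℤ.+ A)) (Σ.sum-involution cls-inv (λ _ → + 1) cls-inv-involutive (λ _ → refl)) ⟨
          Σ.sum {n} (λ _ → + 1) ℤ.- (A ℤ.+ A)
                                    ≡⟨ cong (ℤ._- (A ℤ.+ A)) (trans (sum-ones n) (cong +_ n≡2k)) ⟩
          + k ℤ.+ + k ℤ.- (A ℤ.+ A) ≡⟨ regroup (+ k) A ⟩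
          + k ℤ.- A ℤ.+ (+ k ℤ.- A) ∎)
        where
        open ≡-Reasoning
        A F : ℤ
        A = Σ.sum (Σ.ascendingPart cls-inv (λ _ → + 1))
        F = Σ.sum (Σ.fixedPart cls-inv (λ _ → + 1))
        shift : ∀ a b → a ≡ a ℤ.+ b ℤ.- b
        shift = solve-∀
        regroup : ∀ k a → k ℤ.+ k ℤ.- (a ℤ.+ a) ≡ k ℤ.- a ℤ.+ (k ℤ.- a)
        regroup = solve-∀
        module _ (none : ¬ (∃ λ c → c ≢ one × cls-inv c ≡ c)) where
          off-one : ∀ c → c ≢ one → Σ.fixedPart cls-inv (λ _ → + 1) c ≡ + 0
          off-one c c≢one with cls-inv c Fin.≟ c
          ... | yes fixed = contradiction (c , c≢one , fixed) none
          ... | no _ = refl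
          only-one : Σ.sum (Σ.fixedPart cls-inv (λ _ → + 1)) ≡ + 1
          only-one = trans (Σ.sum-concentrated one off-one)
            (cong (λ b → if b then + 1 else + 0) (dec-true (cls-inv one Fin.≟ one) cls-inv-one))

    i : Fin n
    i = proj₁ other-fixed

    i≢one : i ≢ one
    i≢one = proj₁ (proj₂ other-fixed)

    abstract
      -- A self-inverse class has square ±1, and the square 1 belongs to `one` alone.
      i²≈-1 : ι i ℤ.* ι i ≈ -[1+ 0 ]
      i²≈-1 = by-sign (cls-inv-fixed i (proj₂ (proj₂ other-fixed)))
        where
        by-sign : (∃ λ e → IsSign e × ι i ℤ.* ι i ≈ e) → ι i ℤ.* ι i ≈ -[1+ 0 ]
        by-sign (_ , inj₁ refl , h) = contradiction (ι-square-1 i h) i≢one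
        by-sign (_ , inj₂ refl , h) = h

    ι-square--1 : ∀ c → ι c ℤ.* ι c ≈ -[1+ 0 ] → c ≡ i
    ι-square--1 c h =
      let e , s , q = square-≈ (ι c) (ι i) (≈-trans h (≈-sym i²≈-1))
      in proj₂ (signed-unique {+ 1} {e} {c} {i} (inj₁ refl) s (≈-trans (≡⇒≈ (ℤ.*-identityˡ (ι c))) q))

    sq-one≡sq-i : sq one ≡ sq i
    sq-one≡sq-i = sym (cls-sign-* { -[1+ 0 ]} {ι one ℤ.* ι one} {ι i ℤ.* ι i} (*≉0 (ι≉0 one) (ι≉0 one)) (inj₂ refl)
      (≈-trans i²≈-1 (≡⇒≈ (cong (λ z → -[1+ 0 ] ℤ.* (z ℤ.* z)) (sym ι-one)))))

    abstract
      -- Squaring identifies the classes of 1 and i, so it is not injective and therefore misses a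
      -- class, which contains no square at all.
      nonsquare : ∃ λ y → ¬ (∃ λ x → sq x ≡ y)
      nonsquare = Fin.¬∀⟶∃¬ n (λ y → ∃ λ x → sq x ≡ y) (λ y → Fin.any? (λ x → sq x Fin.≟ y))
        (λ surj → i≢one (sym (surjective⇒injective surj sq-one≡sq-i)))

    b : Fin n
    b = proj₁ nonsquare

    -- The case a = 1 of the pairing: the fixed classes are 1, with sign 1, and i, with sign -1
    -- because 1 / i = -i.
    Π-ε-inv : Π.sum (λ x → ε (inv (ι x))) ≡ -[1+ 0 ]
    Π-ε-inv = begin
      Π.sum (λ x → ε (inv (ι x)))
        ≡⟨ ℤ.*-identityˡ (Π.sum (λ x → ε (inv (ι x)))) ⟨
      + 1 ℤ.* Π.sum (λ x → ε (inv (ι x)))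
        ≡⟨ cong (ℤ._* Π.sum (λ x → ε (inv (ι x)))) χ-1 ⟨
      χ (+ 1) ℤ.* Π.sum (λ x → ε (inv (ι x)))
        ≡⟨ Π-δ-χ ⟨
      Π.sum δ
        ≡⟨ Π-δ ⟩
      Π.sum (Π.fixedPart div δ)
        ≡⟨ Π.sum-concentrated i off-i ⟩
      Π.fixedPart div δ i
        ≡⟨ cong (λ b → if b then δ i else + 1) (dec-true (div i Fin.≟ i) (proj₂ at-i)) ⟩
      δ i
        ≡⟨ proj₁ at-i ⟩
      -[1+ 0 ] ∎
      where
      open ≡-Reasoning
      open Division (+ 1) 1≉0
      -i : -[1+ 0 ] ℤ.* ι i ℤ.* ι i ≈ + 1
      -i = ≈-trans (≡⇒≈ (ℤ.*-assoc -[1+ 0 ] (ι i) (ι i))) (*-congˡ -[1+ 0 ] i²≈-1)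
      at-i : δ i ≡ -[1+ 0 ] × div i ≡ i
      at-i = ε-cls-unique {+ 1 ℤ.* inv (ι i)} { -[1+ 0 ]} {i} (inj₂ refl)
        (≈-trans (≡⇒≈ (ℤ.*-identityˡ (inv (ι i)))) (inv-unique {ι i} { -[1+ 0 ] ℤ.* ι i} -i))
      δ-fixed : ∀ {e} x → x ≢ i → IsSign e → ι x ℤ.* ι x ≈ e ℤ.* + 1 → e ≡ + 1
      δ-fixed x x≢i (inj₁ refl) h = refl
      δ-fixed x x≢i (inj₂ refl) h = contradiction (ι-square--1 x h) x≢i
      off-i : ∀ x → x ≢ i → Π.fixedPart div δ x ≡ + 1
      off-i x x≢i with div x Fin.≟ x
      ... | yes fixed = δ-fixed {δ x} x x≢i (δ-sign x) (div-fixed x fixed)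
      ... | no _ = refl

    -- For a = b the pairing has no fixed class, as x² = ±b is impossible. So the product of the
    -- signs is 1, while it is also χ(b) times -1.
    χ-nonsquare : χ (ι b) ≡ -[1+ 0 ]
    χ-nonsquare = begin
      χ (ι b)                                     ≡⟨ flip (χ (ι b)) ⟩
      ℤ.- (χ (ι b) ℤ.* -[1+ 0 ])                  ≡⟨ cong (λ z → ℤ.- (χ (ι b) ℤ.* z)) Π-ε-inv ⟨
      ℤ.- (χ (ι b) ℤ.* Π.sum (λ x → ε (inv (ι x)))) ≡⟨ cong ℤ.-_ Π-δ-χ ⟨
      ℤ.- Π.sum δ                                 ≡⟨ cong ℤ.-_ Π-δ ⟩
      ℤ.- Π.sum (Π.fixedPart div δ)               ≡⟨ cong ℤ.-_ (Π.sum-neutral no-fixed) ⟩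
      -[1+ 0 ]                                    ∎
      where
      open ≡-Reasoning
      open Division (ι b) (ι≉0 b)
      flip : ∀ z → z ≡ ℤ.- (z ℤ.* -[1+ 0 ])
      flip = solve-∀
      no-fixed : ∀ x → Π.fixedPart div δ x ≡ + 1
      no-fixed x with div x Fin.≟ x
      ... | yes fixed = contradiction (x , proj₂ (ε-cls-unique (δ-sign x) (div-fixed x fixed))) (proj₂ nonsquare)
      ... | no _ = refl

    alt-n : alt n ≡ + 1
    alt-n = trans (cong alt n≡2k) (alt-double k)

    D : Fin n → ℤ
    D c = χ (ι c ℤ.* ι c ℤ.- + 1)

    sum-D : Σ.sum D ≡ -[1+ 0 ]
    sum-D = double-injective (begin
      S ℤ.+ S                              ≡⟨ shift (S ℤ.+ S) ⟩
      + 1 ℤ.+ (S ℤ.+ S) ℤ.- + 1            ≡⟨ cong (λ z → z ℤ.+ (S ℤ.+ S) ℤ.- + 1) alt-n ⟨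
      alt n ℤ.+ (S ℤ.+ S) ℤ.- + 1          ≡⟨ cong (ℤ._- + 1) (sum-χ-square-1 {ι b} χ-nonsquare) ⟩
      -[1+ 0 ] ℤ.+ -[1+ 0 ]                ∎)
      where
      open ≡-Reasoning
      S = Σ.sum D
      shift : ∀ s → s ≡ + 1 ℤ.+ s ℤ.- + 1
      shift = solve-∀

    D-one : D one ≡ + 0
    D-one = χ≈0 (≡⇒≈ (cong (λ z → z ℤ.* z ℤ.- + 1) ι-one))

    D-sign : ∀ c → c ≢ one → IsSign (D c)
    D-sign c c≢one = χ-sign λ h → c≢one (ι-square-1 c (sub≈0⇒≈ h))

    -- Only `D one` vanishes; the other n - 1 values are signs with sum -1, so n / 2 = k of them are
    -- negative.
    sum-neg-D : Σ.sum (neg ∘ D) ≡ + k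
    sum-neg-D = double-injective (begin
      Σ.sum (neg ∘ D) ℤ.+ Σ.sum (neg ∘ D)
        ≡⟨ sum-neg-double {D} zero⊎sign ⟩
      Σ.sum (λ c → D c ℤ.* D c) ℤ.- Σ.sum D
        ≡⟨ cong₂ ℤ._-_
             (sum-except (λ c → D c ℤ.* D c) (λ _ → + 1) one (cong (λ z → z ℤ.* z) D-one) (λ c ne → sign²≡1 {D c} (D-sign c ne)))
             sum-D ⟩
      Σ.sum {n} (λ _ → + 1) ℤ.- + 1 ℤ.- -[1+ 0 ]
        ≡⟨ cong (λ z → z ℤ.- + 1 ℤ.- -[1+ 0 ]) (trans (sum-ones n) (cong +_ n≡2k)) ⟩
      + k ℤ.+ + k ℤ.- + 1 ℤ.- -[1+ 0 ]
        ≡⟨ regroup (+ k ℤ.+ + k) ⟩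
      + k ℤ.+ + k ∎)
      where
      open ≡-Reasoning
      regroup : ∀ k → k ℤ.- + 1 ℤ.- -[1+ 0 ] ≡ k
      regroup = solve-∀
      zero⊎sign : ∀ c → D c ≡ + 0 ⊎ IsSign (D c)
      zero⊎sign c with c Fin.≟ one
      ... | yes refl = inj₁ D-one
      ... | no c≢one = inj₂ (D-sign c c≢one)

    module _ (m : ℤ) (m≉0 : m ≉0) where
      open Inversions m m≉0

      act-i-involutive : ∀ x → act (ι i) (act (ι i) x) ≡ x
      act-i-involutive x = trans (act-cls {ι i} {ι i ℤ.* ι x} (ι≉0 i) (*≉0 (ι≉0 i) (ι≉0 x)))
        (proj₂ (ε-cls-unique {ι i ℤ.* (ι i ℤ.* ι x)} { -[1+ 0 ]} {x} (inj₂ refl)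
          (≈-trans (≡⇒≈ (sym (ℤ.*-assoc (ι i) (ι i) (ι x)))) (*-congʳ (ι x) i²≈-1))))

      act-i-moves : ∀ x → act (ι i) x ≢ x
      act-i-moves x fixed =
        let e , s , q = act-fixed {ι i} x (ι≉0 i) fixed
        in 1≉-1 (≈-trans (≡⇒≈ (sym (sign²≡1 {e} s))) (≈-trans (≈-sym (*-cong q q)) i²≈-1))

      -- τ is constant on the orbits {x , i x}, so the factors of V c come in equal pairs.
      V-generic : ∀ c → ¬ (∃ λ e → IsSign e × ι c ℤ.* ι c ≈ e) → V c ≡ + 1
      V-generic c nd = trans
        (Π-involution (act (ι i)) f act-i-involutive invariant (λ x → V-factor-sign c x nd))
        (Π.sum-neutral no-fixed)
        where
        open ≡-Reasoning
        f : Fin n → ℤ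
        f x = sgn (toℕ (τ (act (ι c) x))) (toℕ (τ x))
        τ-i : ∀ x → τ (act (ι i) x) ≡ τ x
        τ-i x = τ-act-degenerate i x (inj₂ refl) i²≈-1
        τ-c-i : ∀ x → τ (act (ι c) (act (ι i) x)) ≡ τ (act (ι c) x)
        τ-c-i x = begin
          τ (act (ι c) (act (ι i) x))           ≡⟨ τ-act (act (ι i) x) (ι≉0 c) ⟩
          act (ι c ℤ.* ι c) (τ (act (ι i) x))   ≡⟨ cong (act (ι c ℤ.* ι c)) (τ-i x) ⟩
          act (ι c ℤ.* ι c) (τ x)               ≡⟨ τ-act x (ι≉0 c) ⟨
          τ (act (ι c) x)                       ∎
        invariant : ∀ x → f (act (ι i) x) ≡ f x
        invariant x = cong₂ (λ y z → sgn (toℕ y) (toℕ z)) (τ-c-i x) (τ-i x)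
        no-fixed : ∀ x → Π.fixedPart (act (ι i)) f x ≡ + 1
        no-fixed x with act (ι i) x Fin.≟ x
        ... | yes fixed = contradiction fixed (act-i-moves x)
        ... | no _ = refl

      -- At c = 1 both sides vanish. The exceptional ratio is i, where `W` is 0 although `D i` =
      -- χ(-2) is a sign.
      W-generic : ∀ c → c ≢ i → W c ≡ D c
      W-generic c c≢i = by-cases (degenerate? c)
        where
        by-cases : Dec (∃ λ e → IsSign e × ι c ℤ.* ι c ≈ e) → W c ≡ D c
        by-cases (yes (_ , inj₁ refl , h)) = trans (W-degenerate c (inj₁ refl) h) (sym (χ≈0 (≈⇒sub≈0 h)))
        by-cases (yes (_ , inj₂ refl , h)) = contradiction (ι-square--1 c h) c≢i
        by-cases (no nd) = trans (W≡ c) (trans (cong (D c ℤ.*_) (V-generic c nd)) (ℤ.*-identityʳ (D c)))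

      D-i : D i ≡ alt k
      D-i = begin
        χ (ι i ℤ.* ι i ℤ.- + 1)        ≡⟨ χ-cong (+-cong i²≈-1 (≈-refl { -[1+ 0 ]})) ⟩
        χ (ℤ.- + 2)                    ≡⟨ χ-neg (+ 2) ⟩
        alt n ℤ.* χ (+ 2)              ≡⟨ cong (ℤ._* χ (+ 2)) alt-n ⟩
        + 1 ℤ.* χ (+ 2)                ≡⟨ ℤ.*-identityˡ (χ (+ 2)) ⟩
        χ (+ 2)                        ≡⟨ χ-2 ⟩
        Π.sum {n} (λ x → alt (suc (toℕ x))) ≡⟨ cong (λ j → Π.sum {j} (λ x → alt (suc (toℕ x)))) n≡2k ⟩
        Π.sum {k ℕ.+ k} (λ x → alt (suc (toℕ x))) ≡⟨ Π-alt-even k ⟩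
        alt k                          ∎
        where open ≡-Reasoning

      sum-neg-W-even : Σ.sum (neg ∘ W) ≡ + k ℤ.- neg (alt k)
      sum-neg-W-even = trans
        (sum-except (neg ∘ W) (neg ∘ D) i
          (cong neg (W-degenerate { -[1+ 0 ]} i (inj₂ refl) i²≈-1))
          (λ c c≢i → cong neg (W-generic c c≢i)))
        (cong₂ (λ a b → a ℤ.- neg b) sum-neg-D D-i)

  -- K is the number of classes c with negative sign, before the exceptional one is discarded.
  inversions-count : ∀ m → (m≉0 : m ≉0) → ∃ λ K → (p ℕ.+ 1 ≡ K ℕ.* 4 ⊎ p ℕ.+ 1 ≡ 2 ℕ.+ K ℕ.* 4) ×
    + 4 ∣ℤ (+ Inversions.inversions m m≉0 ℤ.+ + Inversions.inversions m m≉0) ℤ.- (+ K ℤ.- neg (alt K))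
  inversions-count m m≉0 =
    let k , parity = even⊎odd n in Sum.[ even k , odd k ]′ parity
    where
    open Inversions m m≉0
    Result : Set
    Result = ∃ λ K → (p ℕ.+ 1 ≡ K ℕ.* 4 ⊎ p ℕ.+ 1 ≡ 2 ℕ.+ K ℕ.* 4) ×
      + 4 ∣ℤ (+ inversions ℤ.+ + inversions) ℤ.- (+ K ℤ.- neg (alt K))
    even : ∀ k → n ≡ k ℕ.+ k → Result
    even k n≡2k = k , inj₂ (trans (cong (ℕ._+ 1) (trans p≡1+2n (cong (λ j → suc (j ℕ.+ j)) n≡2k))) (collect k)) ,
      subst (λ z → + 4 ∣ℤ (+ inversions ℤ.+ + inversions) ℤ.- z) (EvenCase.sum-neg-W-even k n≡2k m m≉0) inversions-mod-4
      where
      collect : ∀ k → suc (k ℕ.+ k ℕ.+ (k ℕ.+ k)) ℕ.+ 1 ≡ 2 ℕ.+ k ℕ.* 4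
      collect = ℕSolver.solve-∀
    odd : ∀ k → n ≡ suc (k ℕ.+ k) → Result
    odd k n≡1+2k = suc k , inj₁ (trans (cong (ℕ._+ 1) (trans p≡1+2n (cong (λ j → suc (j ℕ.+ j)) n≡1+2k))) (collect k)) ,
      subst (λ z → + 4 ∣ℤ (+ inversions ℤ.+ + inversions) ℤ.- z) (OddCase.sum-neg-W-odd k n≡1+2k m m≉0) inversions-mod-4
      where
      collect : ∀ k → suc (suc (k ℕ.+ k) ℕ.+ suc (k ℕ.+ k)) ℕ.+ 1 ≡ suc k ℕ.* 4
      collect = ℕSolver.solve-∀

-- From the count modulo 4 to the floor

%2-cong : ∀ s w → + 2 ∣ℤ + s ℤ.- + w → s % 2 ≡ w % 2
%2-cong s w h = Sum.[ sym ∘ (λ s≤w → go s≤w (subst (+ 2 ∣ℤ_) (flip (+ s) (+ w)) (ℤ∣.∣m⇒∣-m h))) , (λ w≤s → go w≤s h) ]′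
  (ℕ.≤-total s w)
  where
  flip : ∀ a b → ℤ.- (a ℤ.- b) ≡ b ℤ.- a
  flip = solve-∀
  go : ∀ {a b} → a ≤ b → + 2 ∣ℤ + b ℤ.- + a → b % 2 ≡ a % 2
  go {a} {b} a≤b d = trans (cong (_% 2) (sym (ℕ.m+[n∸m]≡n a≤b)))
    (ℕ.%-remove-+ʳ a (ℤ∣.∣⇒∣ᵤ (subst (+ 2 ∣ℤ_) (trans (ℤ.m-n≡m⊖n b a) (ℤ.⊖-≥ a≤b)) d)))

-- The correction `neg (alt K)` is K mod 2, so it rounds K down to 2w, and 2s ≡ 2w mod 4 can be
-- halved.
parity-from-double : ∀ s K w → K ≡ w ℕ.+ w ⊎ K ≡ suc (w ℕ.+ w) →
  + 4 ∣ℤ (+ s ℤ.+ + s) ℤ.- (+ K ℤ.- neg (alt K)) → s % 2 ≡ w % 2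
parity-from-double s K w K≡ (divides q h) = %2-cong s w (divides q (double-injective (begin
  + s ℤ.- + w ℤ.+ (+ s ℤ.- + w)                    ≡⟨ regroup (+ s) (+ w) ⟩
  + s ℤ.+ + s ℤ.- (+ w ℤ.+ + w)                    ≡⟨ cong (ℤ._-_ (+ s ℤ.+ + s)) (rounded K≡) ⟨
  + s ℤ.+ + s ℤ.- (+ K ℤ.- neg (alt K))            ≡⟨ h ⟩
  q ℤ.* + 4                                        ≡⟨ double q ⟩
  q ℤ.* + 2 ℤ.+ q ℤ.* + 2                          ∎)))
  where
  open ≡-Reasoning
  regroup : ∀ s w → s ℤ.- w ℤ.+ (s ℤ.- w) ≡ s ℤ.+ s ℤ.- (w ℤ.+ w)
  regroup = solve-∀
  double : ∀ q → q ℤ.* + 4 ≡ q ℤ.* + 2 ℤ.+ q ℤ.* + 2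
  double = solve-∀
  rounded : K ≡ w ℕ.+ w ⊎ K ≡ suc (w ℕ.+ w) → + K ℤ.- neg (alt K) ≡ + w ℤ.+ + w
  rounded (inj₁ refl) = trans (cong (λ a → + (w ℕ.+ w) ℤ.- neg a) (alt-double w)) (ℤ.+-identityʳ (+ (w ℕ.+ w)))
  rounded (inj₂ refl) = cong (λ a → + suc (w ℕ.+ w) ℤ.- neg (ℤ.- a)) (alt-double w)

[r+8w]/8≡w : ∀ r w → r < 8 → (r + w ℕ.* 8) / 8 ≡ w
[r+8w]/8≡w r w r<8 = trans (ℕ.+-distrib-/-∣ʳ r (ℕ∣.n∣m*n w))
  (cong₂ _+_ (ℕ.m<n⇒m/n≡0 r<8) (ℕ.m*n/n≡m w 8))

-- Here K = ⌊q / 4⌋ and w = ⌊K / 2⌋; in the four cases q leaves the remainder 0, 4, 2 or 6 modulo 8.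
eighth : ∀ q K w → q ≡ K ℕ.* 4 ⊎ q ≡ 2 + K ℕ.* 4 → K ≡ w + w ⊎ K ≡ suc (w + w) → q / 8 ≡ w
eighth q K w (inj₁ refl) (inj₁ refl) = trans (cong (_/ 8) (collect w)) ([r+8w]/8≡w 0 w (s≤s z≤n))
  where
  collect : ∀ w → (w + w) ℕ.* 4 ≡ w ℕ.* 8
  collect = ℕSolver.solve-∀
eighth q K w (inj₁ refl) (inj₂ refl) = trans (cong (_/ 8) (collect w)) ([r+8w]/8≡w 4 w (ℕ.m≤m+n 5 3))
  where
  collect : ∀ w → suc (w + w) ℕ.* 4 ≡ 4 + w ℕ.* 8
  collect = ℕSolver.solve-∀
eighth q K w (inj₂ refl) (inj₁ refl) = trans (cong (_/ 8) (collect w)) ([r+8w]/8≡w 2 w (ℕ.m≤m+n 3 5))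
  where
  collect : ∀ w → 2 + (w + w) ℕ.* 4 ≡ 2 + w ℕ.* 8
  collect = ℕSolver.solve-∀
eighth q K w (inj₂ refl) (inj₂ refl) = trans (cong (_/ 8) (collect w)) ([r+8w]/8≡w 6 w (ℕ.m≤m+n 7 1))
  where
  collect : ∀ w → 2 + suc (w + w) ℕ.* 4 ≡ 6 + w ℕ.* 8
  collect = ℕSolver.solve-∀

theorem2p11 : (p : ℕ) → .{{_ : NonZero p}} → Prime p → p % 2 ≡ 1 → (m : ℤ) → ¬ ((+ p) ∣ m) →
    sPrime p m % 2 ≡ ((p + 1) / 8) % 2
theorem2p11 p p-prime p-odd m p∤m =
  let K , p+1≡ , 4∣ = inversions-count m m≉0
      w , K≡ = even⊎odd K
  in begin
    sPrime p m % 2          ≡⟨ cong (_% 2) sPrime≡inversions ⟩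
    inversions % 2          ≡⟨ parity-from-double inversions K w K≡ 4∣ ⟩
    w % 2                   ≡⟨ cong (_% 2) (eighth (p + 1) K w p+1≡ K≡) ⟨
    ((p + 1) / 8) % 2       ∎
  where
  open ≡-Reasoning
  n : ℕ
  n = p / 2
  double : ∀ k → k ℕ.* 2 ≡ k + k
  double = ℕSolver.solve-∀
  p≡1+2n : p ≡ suc (n + n)
  p≡1+2n = trans (ℕ.m≡m%n+[m/n]*n p 2) (cong₂ _+_ p-odd (double n))
  [p∸1]/2≡n : (p ℕ.∸ 1) / 2 ≡ n
  [p∸1]/2≡n = trans (cong (λ q → (q ℕ.∸ 1) / 2) p≡1+2n)
    (trans (cong (_/ 2) (sym (double n))) (ℕ.m*n/n≡m n 2))
  open HalfSystem p n p≡1+2n p-prime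
  m≉0 : m ≉0
  m≉0 h = p∤m (ℤ∣.∣⇒∣ᵤ (≈0⇒∣ h))
  open Inversions m m≉0
  sPrime≡inversions : sPrime p m ≡ inversions
  sPrime≡inversions = cong (λ k → length (filter
    (λ ij → tilde p (m ℤ.* + (proj₂ ij ℕ.* proj₂ ij)) ℕ.<? tilde p (m ℤ.* + (proj₁ ij ℕ.* proj₁ ij)))
    (pairsBelow k))) [p∸1]/2≡n
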